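{- Let $\alpha,\beta,\gamma$ be compositions with $|\alpha|=|\beta|$, and let $S$ and $T$ be proper caterpillars such that $\Phi(S)=[\alpha\circ\gamma]^*$ and $\Phi(T)=[\beta\circ\gamma]^*$. If $\gamma$ is not a palindrome and $\alpha\neq\beta$, then $U_S\neq U_T$.
   Context: A composition of $n$ is a finite sequence $\beta=\beta_1\cdots\beta_k$ of positive integers with sum $|\beta|=n$ (its size); its length is $k$. Its reverse is $\beta_k\cdots\beta_1$; $\beta$ is a palindrome if it equals its reverse; $[\beta]^*=\{\beta,\text{reverse of }\beta\}$. The near-concatenation of $\alpha=\alpha_1\cdots\alpha_k$ and $\beta=\beta_1\cdots\beta_l$ is $\alpha\odot\beta=\alpha_1\cdots\alpha_{k-1}(\alpha_k+\beta_1)\beta_2\cdots\beta_l$, and $\alpha^{\odot i}=\alpha\odot\cdots\odot\alpha$ ($i$ copies). For compositions $\beta=\beta_1\cdots\beta_k$ and $\alpha$, define $\beta\circ\alpha=\alpha^{\odot\beta_1}\cdot\alpha^{\odot\beta_2}\cdots\alpha^{\odot\beta_k}$, where $\cdot$ denotes concatenation of sequences. For a tree $T=(V,E)$ and $A\subseteq E$, $\lambda(A)$ is the partition of $|V|$ given by the component sizes of $(V,A)$; with $\mathbf{x}_\lambda=x_{\lambda_1}\cdots x_{\lambda_l}$, the $U$-polynomial of a tree is $U_T(\mathbf{x})=\sum_{A\subseteq E}\mathbf{x}_{\lambda(A)}$. A caterpillar is a tree whose internal vertices induce a non-trivial path (the spine); it is proper if every internal vertex is adjacent to a leaf. For a proper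 caterpillar with spine $v_1\cdots v_k$, $\Phi(T)=[\beta_1\cdots\beta_k]^*$ where $\beta_i$ is one plus the number of leaves adjacent to $v_i$. -}

module Defs where

open import Data.Nat using (ℕ; zero; suc; _+_; _≤_; _≡ᵇ_; _<ᵇ_)
open import Data.Nat.Properties using (≤-decTotalOrder; _≟_)
open import Data.Bool using (Bool; true; false; _∧_; _∨_; not; T)
open import Data.Fin using (Fin; toℕ)
open import Data.List using (List; []; _∷_; _++_; length; map; filterᵇ; concatMap; allFin; lookup)
open import Data.Bool.ListAction using (any)
open import Data.List.Properties using (≡-dec)
open import Data.List.Relation.Unary.All using (All)
open import Data.List.Relation.Unary.Unique.Propositional using (Unique)
open import Data.List.Relation.Unary.Linked using (Linked)
open import Data.List.Membership.Propositional using (_∈_)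
open import Data.Product using (Σ; _×_; _,_; ∃)
open import Data.Sum using (_⊎_)
open import Function.Bundles using (_⇔_)
open import Relation.Nullary using (¬_; does)
open import Relation.Binary.PropositionalEquality using (_≡_)
open import Data.List.Sort.InsertionSort ≤-decTotalOrder using (sort)

IsComposition : List ℕ → Set
IsComposition = All (λ x → 1 ≤ x)

_⊙_ : List ℕ → List ℕ → List ℕ
[] ⊙ ys = ys
(x ∷ []) ⊙ [] = x ∷ []
(x ∷ []) ⊙ (y ∷ ys) = (x + y) ∷ ys
(x ∷ y ∷ xs) ⊙ ys = x ∷ ((y ∷ xs) ⊙ ys)

-- α^{⊙ i}  (only used for i ≥ 1, since parts of compositions are positive)
⊙pow : ℕ → List ℕ → List ℕ
⊙pow zero a = []
⊙pow (suc zero) a = a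
⊙pow (suc (suc i)) a = a ⊙ ⊙pow (suc i) a

_∘c_ : List ℕ → List ℕ → List ℕ
β ∘c α = concatMap (λ b → ⊙pow b α) β

Edge : ℕ → Set
Edge n = Fin n × Fin n

eqF : ∀ {n} → Fin n → Fin n → Bool
eqF u v = toℕ u ≡ᵇ toℕ v

adjB : ∀ {n} → List (Edge n) → Fin n → Fin n → Bool
adjB E u v = any (λ e → (eqF (Data.Product.proj₁ e) u ∧ eqF (Data.Product.proj₂ e) v)
                      ∨ (eqF (Data.Product.proj₁ e) v ∧ eqF (Data.Product.proj₂ e) u)) E

Adj : ∀ {n} → List (Edge n) → Fin n → Fin n → Set
Adj E u v = T (adjB E u v)

count : ∀ {A : Set} → (A → Bool) → List A → ℕ
count p xs = length (filterᵇ p xs)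

deg : ∀ {n} → List (Edge n) → Fin n → ℕ
deg E v = count (λ e → eqF v (Data.Product.proj₁ e) ∨ eqF v (Data.Product.proj₂ e)) E

leavesAt : ∀ {n} → List (Edge n) → Fin n → ℕ
leavesAt {n} E v = count (λ w → adjB E v w ∧ (deg E w ≡ᵇ 1)) (allFin n)

record Graph (n : ℕ) : Set where
  field
    edges   : List (Edge n)
    ordered : All (λ e → toℕ (Data.Product.proj₁ e) Data.Nat.< toℕ (Data.Product.proj₂ e)) edges
    noDup   : Unique edges
open Graph public

data Walk {n} (E : List (Edge n)) : Fin n → Fin n → Set where
  here  : ∀ {u} → Walk E u u
  there : ∀ {u w v} → Adj E u w → Walk E w v → Walk E u v

Connected : ∀ {n} → Graph n → Set
Connected {n} G = (u v : Fin n) → Walk (edges G) u v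

Cycle : ∀ {n} → Graph n → Set
Cycle {n} G = Σ (Fin n) λ x → Σ (List (Fin n)) λ rest →
  Unique (x ∷ rest) × (2 ≤ length rest) × Linked (Adj (edges G)) (x ∷ rest ++ x ∷ [])

IsTree : ∀ {n} → Graph n → Set
IsTree {n} G = (1 ≤ n) × Connected G × ¬ Cycle G

record ProperSpine {n} (G : Graph n) (spine : List (Fin n)) : Set where
  field
    tree       : IsTree G
    distinct   : Unique spine
    nontrivial : 2 ≤ length spine
    internal   : (v : Fin n) → (v ∈ spine) ⇔ (2 ≤ deg (edges G) v)
    inducedPath : (i j : Fin (length spine)) →
      Adj (edges G) (lookup spine i) (lookup spine j) ⇔ ((suc (toℕ i) ≡ toℕ j) ⊎ (suc (toℕ j) ≡ toℕ i))
    proper     : All (λ v → ∃ λ w → Adj (edges G) v w × deg (edges G) w ≡ 1) spine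

spineSeq : ∀ {n} → Graph n → List (Fin n) → List ℕ
spineSeq G spine = map (λ v → suc (leavesAt (edges G) v)) spine

-- G is a proper caterpillar and Φ(G) = [c]* = {c , reverse c}
HasΦ : ∀ {n} → Graph n → List ℕ → Set
HasΦ {n} G c = Σ (List (Fin n)) λ spine → ProperSpine G spine ×
  (spineSeq G spine ≡ c ⊎ spineSeq G spine ≡ Data.List.reverse c)

subsets : ∀ {A : Set} → List A → List (List A)
subsets [] = [] ∷ []
subsets (x ∷ xs) = let s = subsets xs in s ++ map (x ∷_) s

stepR : ∀ {n} → List (Edge n) → (Fin n → Bool) → (Fin n → Bool)
stepR {n} A S v = S v ∨ any (λ w → S w ∧ adjB A w v) (allFin n)

iterR : ∀ {n} → ℕ → List (Edge n) → (Fin n → Bool) → (Fin n → Bool)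
iterR zero A S = S
iterR (suc k) A S = stepR A (iterR k A S)

compOf : ∀ {n} → List (Edge n) → Fin n → Fin n → Bool
compOf {n} A u = iterR n A (eqF u)

isRep : ∀ {n} → List (Edge n) → Fin n → Bool
isRep {n} A u = not (any (λ w → compOf A u w ∧ (toℕ w <ᵇ toℕ u)) (allFin n))

λpart : ∀ {n} → List (Edge n) → List ℕ
λpart {n} A = sort (map (λ u → count (compOf A u) (allFin n)) (filterᵇ (isRep A) (allFin n)))

-- U_G(x) = Σ_{A ⊆ E} x_{λ(A)}; U G μ is the coefficient of the monomial x_μ
-- (μ a partition written as a weakly increasing list; other lists get coefficient 0).
U : ∀ {n} → Graph n → List ℕ → ℕ
U G μ = count (λ A → does (≡-dec _≟_ (λpart A) μ)) (subsets (edges G))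

{-# OPTIONS --safe #-}
-- A symmetric statistic of λ(A), summed over all edge sets A, is determined by U.  Let b be
-- the spine sequence of a proper caterpillar on M vertices.  Partitions with two parts give the
-- number of leaves (one part is 1) and, for each k, the number of sides of size k of spine edges
-- (no part is 1, since both sides have at least two vertices).  Partitions {1, k, M - 1 - k} come
-- from deleting a spine edge and a leaf edge; writing f k for the number of pairs (side of size k
-- of a spine edge, leaf on that side) and f′ k for the same with the leaf on the other side, they
-- give f (k + 1) + f′ k.  As f k + f′ k is (number of leaves) × (number of sides of size k), all
-- values f k follow by induction on k.
-- Since γ is not a palindrome, it has a prefix sum d that is not a suffix sum.  At the first
-- difference of α and β, take the cuts of α ∘ γ and β ∘ γ at the position congruent to d just
-- after the shorter part: both cut at the same size k, no suffix of either has sum k, and the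
-- prefixes differ by one in length, so f k differs.
module Submission where

open import Defs
open import Data.Bool using (Bool; true; false; if_then_else_; _∧_; _∨_; not; T)
open import Data.Bool.ListAction using (any)
open import Data.Bool.Properties using (T?; T-∧; T-∨; T-≡)
open import Data.Fin using (Fin; toℕ; inject₁; zero; suc)
import Data.Fin.Properties as Fin
open import Data.List using (List; []; _∷_; _++_; [_]; _ʳ++_; map; length; filterᵇ; filter; allFin; lookup; reverse)
open import Data.List.Properties
  using (map-++; map-∘; map-cong; map-cong-local; length-filter; length-tabulate; ≡-dec;
         ++-assoc; ++-identityʳ; ∷-injectiveʳ; reverse-involutive; reverse-++)
open import Data.List.Membership.Propositional using (_∈_; _∉_)
open import Data.List.Membership.Propositional.Properties
  using (∈-∃++; ∈-allFin; ∈-lookup; ∈-filter⁺; ∈-filter⁻; ∈-map⁺; ∈-map⁻; ∈-++⁺ˡ; ∈-++⁺ʳ; ∈-++⁻)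
open import Data.List.Membership.Propositional.Properties.WithK using (unique∧set⇒bag)
import Data.List.Membership.DecPropositional as DecMembership
open import Data.List.Relation.Unary.All as All using (All; []; _∷_)
import Data.List.Relation.Unary.All.Properties as All
open import Data.List.Relation.Unary.AllPairs as AllPairs using ([]; _∷_)
open import Data.List.Relation.Unary.Any as Any using (Any; here; there)
import Data.List.Relation.Unary.Any.Properties as Any
open import Data.List.Relation.Unary.Linked using (Linked; []; [-]; _∷_)
open import Data.List.Relation.Unary.Unique.Propositional using (Unique)
import Data.List.Relation.Unary.Unique.Propositional.Properties as Unique
open import Data.List.Relation.Binary.BagAndSetEquality using (∼bag⇒↭)
open import Data.List.Relation.Binary.Permutation.Propositional as ↭
  using (_↭_; ↭-sym; ↭-trans; ↭-refl; ↭-reflexive)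
open import Data.List.Relation.Binary.Permutation.Propositional.Properties
  using (↭-reverse; ↭-length; All-resp-↭; ∈-resp-↭; map⁺; shift)
open import Data.List.Relation.Ternary.Interleaving.Propositional
  using (Interleaving; []; consˡ; consʳ; toPermutation)
open import Data.List.Sort.InsertionSort.Properties using (sort-↭)
open import Data.Nat using (ℕ; zero; suc; pred; _+_; _*_; _≤_; _<_; z≤n; s≤s; _≡ᵇ_; _≤ᵇ_; _<ᵇ_)
open import Data.Nat.Induction using (<-wellFounded)
open import Data.Nat.ListAction using (sum)
open import Data.Nat.ListAction.Properties using (sum-++; sum-↭)
open import Data.Nat.Properties
open import Data.Nat.Tactic.RingSolver using (solve-∀)
open import Data.Product using (∃; ∃₂; _×_; _,_; proj₁; proj₂)
open import Data.Sum using (_⊎_; inj₁; inj₂; [_,_]′)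
open import Function using (_∘_; flip)
open import Function.Bundles using (_⇔_; mk⇔; module Equivalence)
open Equivalence using (to; from)
open import Induction.WellFounded using (Acc; acc)
open import Relation.Binary using (DecidableEquality; tri<; tri≈; tri>)
open import Relation.Binary.PropositionalEquality hiding ([_])
open import Relation.Nullary using (¬_; Dec; yes; no; does; contradiction; ¬?)
open import Relation.Nullary.Decidable using (_×-dec_; dec-true; dec-false; toSum)

-- `Φ` fixes a spine sequence only up to reversal, so f k has to treat the two sides of a spine edge
-- alike. A suffix of sum k then contributes to f k just as a prefix does, and only a size that no
-- suffix attains isolates a single prefix. The length of that prefix is visible because part x
-- carries x - 1 leaves: a prefix of sum k and length l carries k - l of them. Deleting two leaf
-- edges leaves the parts 1, 1, M - 2, which would spoil the three-part count at k = 1 and k = M -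
-- 2. It is therefore used for k from 2 to M - 3 and yields f k for k from 2 to M - 2, precisely the
-- range in which the sides of a spine edge have their sizes. On the graph side λ(A) is computed by
-- iterated reachability from least vertices. To evaluate it, the tree is rooted at an end of the
-- spine, each edge is identified with its lower endpoint, and each component is named by its
-- highest vertex.

χ : Bool → ℕ
χ b = if b then 1 else 0

≡ᵇ-refl : ∀ k → (k ≡ᵇ k) ≡ true
≡ᵇ-refl zero = refl
≡ᵇ-refl (suc k) = ≡ᵇ-refl k

≢⇒≡ᵇ-false : ∀ {j k} → j ≢ k → (j ≡ᵇ k) ≡ false
≢⇒≡ᵇ-false {zero} {zero} j≢k = contradiction refl j≢k
≢⇒≡ᵇ-false {zero} {suc k} j≢k = refl
≢⇒≡ᵇ-false {suc j} {zero} j≢k = refl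
≢⇒≡ᵇ-false {suc j} {suc k} j≢k = ≢⇒≡ᵇ-false (j≢k ∘ cong suc)

-- Near-concatenation

⊙-identityʳ : ∀ xs → xs ⊙ [] ≡ xs
⊙-identityʳ [] = refl
⊙-identityʳ (x ∷ []) = refl
⊙-identityʳ (x ∷ y ∷ xs) = cong (x ∷_) (⊙-identityʳ (y ∷ xs))

∷-⊙-∷ : ∀ x xs y ys → ∃₂ λ z zs → (x ∷ xs) ⊙ (y ∷ ys) ≡ z ∷ zs
∷-⊙-∷ x [] y ys = x + y , ys , refl
∷-⊙-∷ x (x′ ∷ xs) y ys = x , _ , refl

∷-++-⊙ : ∀ xs y ys zs → (xs ++ y ∷ ys) ⊙ zs ≡ xs ++ ((y ∷ ys) ⊙ zs)
∷-++-⊙ [] y ys zs = refl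
∷-++-⊙ (x ∷ []) y ys zs = refl
∷-++-⊙ (x ∷ x′ ∷ xs) y ys zs = cong (x ∷_) (∷-++-⊙ (x′ ∷ xs) y ys zs)

⊙-∷-++ : ∀ xs y ys zs → xs ⊙ ((y ∷ ys) ++ zs) ≡ (xs ⊙ (y ∷ ys)) ++ zs
⊙-∷-++ [] y ys zs = refl
⊙-∷-++ (x ∷ []) y ys zs = refl
⊙-∷-++ (x ∷ x′ ∷ xs) y ys zs = cong (x ∷_) (⊙-∷-++ (x′ ∷ xs) y ys zs)

⊙-assoc : ∀ xs ys zs → (xs ⊙ ys) ⊙ zs ≡ xs ⊙ (ys ⊙ zs)
⊙-assoc [] ys zs = refl
⊙-assoc (x ∷ []) [] zs = refl
⊙-assoc (x ∷ []) (y ∷ []) [] = refl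
⊙-assoc (x ∷ []) (y ∷ []) (z ∷ zs) = cong (_∷ zs) (+-assoc x y z)
⊙-assoc (x ∷ []) (y ∷ y′ ∷ ys) zs = refl
⊙-assoc (x ∷ x′ ∷ []) [] zs = refl
⊙-assoc (x ∷ x′ ∷ []) (y ∷ ys) zs = cong (x ∷_) (⊙-assoc (x′ ∷ []) (y ∷ ys) zs)
⊙-assoc (x ∷ x′ ∷ x″ ∷ xs) ys zs = cong (x ∷_) (⊙-assoc (x′ ∷ x″ ∷ xs) ys zs)

⊙pow-suc : ∀ n xs → ⊙pow (suc n) xs ≡ xs ⊙ ⊙pow n xs
⊙pow-suc zero xs = sym (⊙-identityʳ xs)
⊙pow-suc (suc n) xs = refl

⊙pow-+ : ∀ m n xs → ⊙pow (m + n) xs ≡ ⊙pow m xs ⊙ ⊙pow n xs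
⊙pow-+ zero n xs = refl
⊙pow-+ (suc m) n xs = begin
  ⊙pow (suc (m + n)) xs           ≡⟨ ⊙pow-suc (m + n) xs ⟩
  xs ⊙ ⊙pow (m + n) xs            ≡⟨ cong (xs ⊙_) (⊙pow-+ m n xs) ⟩
  xs ⊙ (⊙pow m xs ⊙ ⊙pow n xs)    ≡⟨ ⊙-assoc xs _ _ ⟨
  (xs ⊙ ⊙pow m xs) ⊙ ⊙pow n xs    ≡⟨ cong (_⊙ ⊙pow n xs) (⊙pow-suc m xs) ⟨
  ⊙pow (suc m) xs ⊙ ⊙pow n xs     ∎
  where open ≡-Reasoning

sum-⊙ : ∀ xs ys → sum (xs ⊙ ys) ≡ sum xs + sum ys
sum-⊙ [] ys = refl
sum-⊙ (x ∷ []) [] = sym (+-identityʳ _)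
sum-⊙ (x ∷ []) (y ∷ ys) = trans (+-assoc x y _) (cong (_+ (y + sum ys)) (sym (+-identityʳ x)))
sum-⊙ (x ∷ x′ ∷ xs) ys = trans (cong (x +_) (sum-⊙ (x′ ∷ xs) ys)) (sym (+-assoc x _ _))

sum-⊙pow : ∀ n xs → sum (⊙pow n xs) ≡ n * sum xs
sum-⊙pow zero xs = refl
sum-⊙pow (suc n) xs = trans (cong sum (⊙pow-suc n xs)) (trans (sum-⊙ xs _) (cong (sum xs +_) (sum-⊙pow n xs)))

⊙-composition : ∀ {xs ys} → IsComposition xs → IsComposition ys → IsComposition (xs ⊙ ys)
⊙-composition [] pys = pys
⊙-composition (px ∷ []) [] = px ∷ []
⊙-composition (px ∷ []) (py ∷ pys) = m≤n⇒m≤n+o _ px ∷ pys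
⊙-composition (px ∷ px′ ∷ pxs) pys = px ∷ ⊙-composition (px′ ∷ pxs) pys

⊙pow-composition : ∀ n {xs} → IsComposition xs → IsComposition (⊙pow n xs)
⊙pow-composition zero pxs = []
⊙pow-composition (suc n) {xs} pxs =
  subst IsComposition (sym (⊙pow-suc n xs)) (⊙-composition pxs (⊙pow-composition n pxs))

sum-∘c : ∀ α γ → sum (α ∘c γ) ≡ sum α * sum γ
sum-∘c [] γ = refl
sum-∘c (a ∷ α) γ = begin
  sum (⊙pow a γ ++ α ∘c γ)         ≡⟨ sum-++ (⊙pow a γ) _ ⟩
  sum (⊙pow a γ) + sum (α ∘c γ)    ≡⟨ cong₂ _+_ (sum-⊙pow a γ) (sum-∘c α γ) ⟩
  a * sum γ + sum α * sum γ        ≡⟨ *-distribʳ-+ (sum γ) a (sum α) ⟨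
  (a + sum α) * sum γ              ∎
  where open ≡-Reasoning

leaves : List ℕ → ℕ
leaves = sum ∘ map pred

leaves-++ : ∀ xs ys → leaves (xs ++ ys) ≡ leaves xs + leaves ys
leaves-++ xs ys = trans (cong sum (map-++ pred xs ys)) (sum-++ (map pred xs) _)

-- Merging parts x and y gives one part with x + y - 1 leaves, against (x - 1) + (y - 1) for the two
-- kept apart. This one extra leaf is the whole difference detected in `separated-<`.
leaves-⊙ : ∀ x xs y ys → IsComposition (x ∷ xs) → IsComposition (y ∷ ys) →
  leaves ((x ∷ xs) ⊙ (y ∷ ys)) ≡ suc (leaves (x ∷ xs) + leaves (y ∷ ys))
leaves-⊙ (suc x) [] zero ys _ (() ∷ _)
leaves-⊙ (suc x) [] (suc y) ys _ _ = begin
  x + suc y + leaves ys              ≡⟨ cong (_+ leaves ys) (+-suc x y) ⟩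
  suc (x + y + leaves ys)            ≡⟨ cong suc (+-assoc x y _) ⟩
  suc (x + (y + leaves ys))          ≡⟨ cong (λ z → suc (z + (y + leaves ys))) (+-identityʳ x) ⟨
  suc (x + 0 + (y + leaves ys))      ∎
  where open ≡-Reasoning
leaves-⊙ x (x′ ∷ xs) y ys (_ ∷ pxs) pys =
  trans (cong (pred x +_) (leaves-⊙ x′ xs y ys pxs pys))
        (trans (+-suc (pred x) _) (cong suc (sym (+-assoc (pred x) _ _))))

-- Prefix and suffix sums

SuffixSum : List ℕ → ℕ → Set
SuffixSum xs t = ∃₂ λ ps ss → xs ≡ ps ++ ss × sum ss ≡ t

suffixSum-++ : ∀ xs ys {t} → SuffixSum (xs ++ ys) t →
  SuffixSum ys t ⊎ (∃ λ s → SuffixSum xs s × t ≡ s + sum ys)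
suffixSum-++ [] ys s = inj₁ s
suffixSum-++ (x ∷ xs) ys ([] , ss , refl , refl) =
  inj₂ (_ , ([] , x ∷ xs , refl , refl) , sum-++ (x ∷ xs) ys)
suffixSum-++ (x ∷ xs) ys (p ∷ ps , ss , eq , refl) with suffixSum-++ xs ys (ps , ss , ∷-injectiveʳ eq , refl)
... | inj₁ s = inj₁ s
... | inj₂ (_ , (ps′ , ss′ , eq″ , refl) , eq′) = inj₂ (_ , (x ∷ ps′ , ss′ , cong (x ∷_) eq″ , refl) , eq′)

-- The merged part cannot be cut, so a suffix that starts with it is counted with `xs`: it consists
-- of a suffix of `xs` followed by all of `ys`.
suffixSum-⊙ : ∀ xs ys {t} → SuffixSum (xs ⊙ ys) t →
  SuffixSum ys t ⊎ (∃ λ s → SuffixSum xs s × t ≡ s + sum ys)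
suffixSum-⊙ [] ys s = inj₁ s
suffixSum-⊙ (x ∷ []) [] {t} s = inj₂ (t , s , sym (+-identityʳ t))
suffixSum-⊙ (x ∷ []) (y ∷ ys) ([] , ss , refl , refl) =
  inj₂ (_ , ([] , x ∷ [] , refl , refl) , sum-⊙ (x ∷ []) (y ∷ ys))
suffixSum-⊙ (x ∷ []) (y ∷ ys) (p ∷ ps , ss , refl , refl) = inj₁ (y ∷ ps , ss , refl , refl)
suffixSum-⊙ (x ∷ x′ ∷ xs) ys ([] , ss , refl , refl) =
  inj₂ (_ , ([] , x ∷ x′ ∷ xs , refl , refl) , sum-⊙ (x ∷ x′ ∷ xs) ys)
suffixSum-⊙ (x ∷ x′ ∷ xs) ys (p ∷ ps , ss , eq , refl)
  with suffixSum-⊙ (x′ ∷ xs) ys (ps , ss , ∷-injectiveʳ eq , refl)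
... | inj₁ s = inj₁ s
... | inj₂ (_ , (ps′ , ss′ , eq″ , refl) , eq′) = inj₂ (_ , (x ∷ ps′ , ss′ , cong (x ∷_) eq″ , refl) , eq′)

-- Modulo `sum γ`, suffix sums of a `∘c`-product are suffix sums of `γ`: every later copy of `γ`
-- adds one full period, whether it is attached by `⊙` or by `++`.
PeriodicSuffixSum : List ℕ → ℕ → Set
PeriodicSuffixSum γ t = ∃₂ λ q e → SuffixSum γ e × t ≡ e + q * sum γ

periodic-+ : ∀ γ n {s t} → PeriodicSuffixSum γ s → t ≡ s + n * sum γ → PeriodicSuffixSum γ t
periodic-+ γ n (q , e , se , refl) refl =
  q + n , e , se , trans (+-assoc e _ _) (cong (e +_) (sym (*-distribʳ-+ (sum γ) q n)))

suffixSum-⊙pow : ∀ n γ {t} → SuffixSum (⊙pow n γ) t → PeriodicSuffixSum γ t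
suffixSum-⊙pow zero γ ([] , [] , refl , refl) = 0 , 0 , (γ , [] , sym (++-identityʳ γ) , refl) , refl
suffixSum-⊙pow (suc n) γ s with suffixSum-⊙ γ (⊙pow n γ) (subst (λ z → SuffixSum z _) (⊙pow-suc n γ) s)
... | inj₁ s′ = suffixSum-⊙pow n γ s′
... | inj₂ (e , se , eq) = n , e , se , trans eq (cong (e +_) (sum-⊙pow n γ))

suffixSum-∘c : ∀ α γ {t} → SuffixSum (α ∘c γ) t → PeriodicSuffixSum γ t
suffixSum-∘c [] γ ([] , [] , refl , refl) = 0 , 0 , (γ , [] , sym (++-identityʳ γ) , refl) , refl
suffixSum-∘c (a ∷ α) γ s with suffixSum-++ (⊙pow a γ) (α ∘c γ) s
... | inj₁ s′ = suffixSum-∘c α γ s′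
... | inj₂ (e , se , eq) = periodic-+ γ (sum α) (suffixSum-⊙pow a γ se) (trans eq (cong (e +_) (sum-∘c α γ)))

-- The bound on `e` is weak because a suffix of `γ` may be all of `γ`. Since `d` lies strictly
-- between 0 and `g`, neither extreme value of `e` has the residue of `d`.
remainder-unique : ∀ q j {e d g} → e ≤ g → 1 ≤ d → d < g → e + q * g ≡ d + j * g → e ≡ d
remainder-unique zero zero {e} {d} _ _ _ eq = trans (sym (+-identityʳ e)) (trans eq (+-identityʳ d))
remainder-unique zero (suc j) {e} {d} {g} e≤g 1≤d d<g eq = contradiction (begin-strict
  g                  <⟨ m<n+m g 1≤d ⟩
  d + g              ≤⟨ +-monoʳ-≤ d (m≤m+n g (j * g)) ⟩
  d + (g + j * g)    ≡⟨ eq ⟨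
  e + 0              ≡⟨ +-identityʳ e ⟩
  e                  ≤⟨ e≤g ⟩
  g                  ∎) (<-irrefl refl)
  where open ≤-Reasoning
remainder-unique (suc q) zero {e} {d} {g} e≤g 1≤d d<g eq = contradiction (begin-strict
  d                  <⟨ d<g ⟩
  g                  ≤⟨ m≤m+n g (q * g) ⟩
  g + q * g          ≤⟨ m≤n+m _ e ⟩
  e + (g + q * g)    ≡⟨ eq ⟩
  d + 0              ≡⟨ +-identityʳ d ⟩
  d                  ∎) (<-irrefl refl)
  where open ≤-Reasoning
remainder-unique (suc q) (suc j) {e} {d} {g} e≤g 1≤d d<g eq =
  remainder-unique q j e≤g 1≤d d<g (+-cancelˡ-≡ g _ _ (begin
    g + (e + q * g)    ≡⟨ swap g e (q * g) ⟩
    e + (g + q * g)    ≡⟨ eq ⟩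
    d + (g + j * g)    ≡⟨ swap g d (j * g) ⟨
    g + (d + j * g)    ∎))
  where
  open ≡-Reasoning
  swap : ∀ a b c → a + (b + c) ≡ b + (a + c)
  swap = solve-∀

-- `S` is a parameter because comparing `γ` with its reverse yields an escape from prefix sums,
-- which is then converted into an escape from suffix sums.
PrefixEscapes : List ℕ → (ℕ → Set) → Set
PrefixEscapes xs S = ∃₂ λ ps rs → xs ≡ ps ++ rs × ¬ S (sum ps)

PrefixSum : List ℕ → ℕ → Set
PrefixSum xs t = ∃₂ λ ps ss → xs ≡ ps ++ ss × sum ps ≡ t

prefix-escapes-∷ : ∀ x {xs ys} → 1 ≤ x → PrefixEscapes xs (PrefixSum ys) → PrefixEscapes (x ∷ xs) (PrefixSum (x ∷ ys))
prefix-escapes-∷ (suc x) _ (ps , rs , refl , esc) = suc x ∷ ps , rs , refl , λ where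
  (q ∷ qs , ss , refl , eq) → esc (qs , ss , refl , +-cancelˡ-≡ q _ _ eq)

prefix-escapes-< : ∀ {x y} xs ys → 1 ≤ x → x < y → PrefixEscapes (x ∷ xs) (PrefixSum (y ∷ ys))
prefix-escapes-< {x} {y} xs ys 1≤x x<y = [ x ] , xs , refl , λ where
  ([] , ss , refl , eq) → <⇒≢ 1≤x (trans eq (+-identityʳ x))
  (q ∷ qs , ss , refl , eq) → <⇒≱ x<y (≤-trans (m≤m+n y (sum qs)) (≤-reflexive (trans eq (+-identityʳ x))))

-- The end of the smaller of the first two differing parts is a prefix sum that the other list jumps
-- over. Either list may have the smaller part, hence the disjunction.
first-difference : ∀ {xs ys} → IsComposition xs → IsComposition ys → sum xs ≡ sum ys → xs ≢ ys →
  PrefixEscapes xs (PrefixSum ys) ⊎ PrefixEscapes ys (PrefixSum xs)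
first-difference [] [] _ xs≢ys = contradiction refl xs≢ys
first-difference [] (s≤s _ ∷ _) () _
first-difference (s≤s _ ∷ _) [] () _
first-difference {x ∷ xs} {y ∷ ys} (px ∷ pxs) (py ∷ pys) eq xs≢ys with <-cmp x y
... | tri< x<y _ _ = inj₁ (prefix-escapes-< xs ys px x<y)
... | tri> _ _ y<x = inj₂ (prefix-escapes-< ys xs py y<x)
... | tri≈ _ refl _ with first-difference pxs pys (+-cancelˡ-≡ x _ _ eq) (xs≢ys ∘ cong (x ∷_))
...   | inj₁ esc = inj₁ (prefix-escapes-∷ x px esc)
...   | inj₂ esc = inj₂ (prefix-escapes-∷ x px esc)

sum-reverse : ∀ xs → sum (reverse xs) ≡ sum xs
sum-reverse xs = sum-↭ (↭-reverse xs)

suffixSum⇒prefixSum-reverse : ∀ {xs t} → SuffixSum xs t → PrefixSum (reverse xs) t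
suffixSum⇒prefixSum-reverse (ps , ss , refl , refl) = reverse ss , reverse ps , reverse-++ ps ss , sum-reverse ss

-- A prefix of the reverse is a suffix of `xs`, and the witness is the prefix left over by it. If a
-- suffix had the sum of this witness, the complement of that suffix would be a prefix with the
-- forbidden sum.
prefix-escapes-reverse : ∀ {xs} → PrefixEscapes (reverse xs) (PrefixSum xs) → PrefixEscapes xs (SuffixSum xs)
prefix-escapes-reverse {xs} (ps , rs , eq , esc) = reverse rs , reverse ps , xs≡ , λ where
      (ps′ , ss′ , refl , eq′) → esc (ps′ , ss′ , refl , +-cancelʳ-≡ (sum ss′) _ _ (begin
        sum ps′ + sum ss′                  ≡⟨ sum-++ ps′ ss′ ⟨
        sum (ps′ ++ ss′)                   ≡⟨ cong sum xs≡ ⟩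
        sum (reverse rs ++ reverse ps)     ≡⟨ sum-++ (reverse rs) _ ⟩
        sum (reverse rs) + sum (reverse ps) ≡⟨ +-comm (sum (reverse rs)) _ ⟩
        sum (reverse ps) + sum (reverse rs) ≡⟨ cong₂ _+_ (sum-reverse ps) (sym eq′) ⟩
        sum ps + sum ss′                   ∎))
  where
  open ≡-Reasoning
  xs≡ : xs ≡ reverse rs ++ reverse ps
  xs≡ = trans (sym (reverse-involutive xs)) (trans (cong reverse eq) (reverse-++ ps rs))

non-palindrome-escapes : ∀ {γ} → IsComposition γ → reverse γ ≢ γ → PrefixEscapes γ (SuffixSum γ)
non-palindrome-escapes {γ} pγ γ≢
  with first-difference pγ (All-resp-↭ (↭-sym (↭-reverse γ)) pγ) (sym (sum-reverse γ)) (γ≢ ∘ sym)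
... | inj₁ (ps , rs , eq , esc) = ps , rs , eq , λ s → esc (suffixSum⇒prefixSum-reverse s)
... | inj₂ esc = prefix-escapes-reverse esc

-- Sums over the ways of cutting a list into two nonempty pieces

splitSum : {A : Set} → (List A → List A → ℕ) → List A → List A → ℕ
splitSum φ ps [] = 0
splitSum φ ps (x ∷ xs) = φ ps (x ∷ xs) + splitSum φ (x ∷ ps) xs

-- The left piece is handed to φ in reverse order.
cuts : {A : Set} → (List A → List A → ℕ) → List A → ℕ
cuts φ [] = 0
cuts φ (x ∷ xs) = splitSum φ (x ∷ []) xs

splitSum-cong : ∀ {A : Set} {φ ψ : List A → List A → ℕ} → (∀ xs ys → φ xs ys ≡ ψ xs ys) →
  ∀ ps xs → splitSum φ ps xs ≡ splitSum ψ ps xs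
splitSum-cong eq ps [] = refl
splitSum-cong eq ps (x ∷ xs) = cong₂ _+_ (eq ps (x ∷ xs)) (splitSum-cong eq (x ∷ ps) xs)

splitSum-+ : ∀ {A : Set} (φ ψ : List A → List A → ℕ) ps xs →
  splitSum (λ ys zs → φ ys zs + ψ ys zs) ps xs ≡ splitSum φ ps xs + splitSum ψ ps xs
splitSum-+ φ ψ ps [] = refl
splitSum-+ φ ψ ps (x ∷ xs) = trans (cong (φ ps (x ∷ xs) + ψ ps (x ∷ xs) +_) (splitSum-+ φ ψ (x ∷ ps) xs))
  (interchange (φ ps (x ∷ xs)) (ψ ps (x ∷ xs)) _ _)
  where
  interchange : ∀ a b c d → a + b + (c + d) ≡ a + c + (b + d)
  interchange = solve-∀

cuts-+ : ∀ {A : Set} (φ ψ : List A → List A → ℕ) xs →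
  cuts (λ ys zs → φ ys zs + ψ ys zs) xs ≡ cuts φ xs + cuts ψ xs
cuts-+ φ ψ [] = refl
cuts-+ φ ψ (x ∷ xs) = splitSum-+ φ ψ (x ∷ []) xs

module _ {A : Set} (φ : List A → List A → ℕ) where

  private
    -- The cuts strictly to the left of the current position, the one with an empty left piece
    -- included. `splitSum` collects the current cut and those to the right, except the one with an
    -- empty right piece.
    splitSumBefore : List A → List A → ℕ
    splitSumBefore [] xs = 0
    splitSumBefore (p ∷ ps) xs = φ ps (p ∷ xs) + splitSumBefore ps (p ∷ xs)

    move-right : ∀ ps xs → splitSum φ ps xs + splitSumBefore ps xs ≡ splitSumBefore (xs ʳ++ ps) []
    move-right ps [] = refl
    move-right ps (x ∷ xs) = trans (swap (φ ps (x ∷ xs)) (splitSum φ (x ∷ ps) xs) _) (move-right (x ∷ ps) xs)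
      where
      swap : ∀ a b c → a + b + c ≡ b + (a + c)
      swap = solve-∀

    move-left : ∀ ps xs → φ ps xs + splitSumBefore ps xs ≡ splitSum (flip φ) xs ps + φ [] (ps ʳ++ xs)
    move-left [] xs = +-comm _ 0
    move-left (p ∷ ps) xs = trans (cong (φ (p ∷ ps) xs +_) (move-left ps (p ∷ xs))) (sym (+-assoc (φ (p ∷ ps) xs) _ _))

    splitSum-cuts : ∀ xs → φ [] [] ≡ 0 → splitSum φ [] xs ≡ φ [] xs + cuts φ xs
    splitSum-cuts [] φ[] = sym (trans (+-identityʳ _) φ[])
    splitSum-cuts (x ∷ xs) φ[] = refl

  -- Because the left piece is kept reversed, reading the list from its other end exchanges the two
  -- pieces of a cut exactly, so symmetry of `φ` suffices. The terms with an empty left piece are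
  -- added for `xs` and for its reverse, since `splitSum` started at `[]` contains them.
  cuts-reverse : (∀ xs ys → φ xs ys ≡ φ ys xs) → φ [] [] ≡ 0 → ∀ xs → cuts φ (reverse xs) ≡ cuts φ xs
  cuts-reverse φ-sym φ[] xs = +-cancelˡ-≡ (φ [] xs + φ [] (reverse xs)) _ _ (begin
    φ [] xs + φ [] (reverse xs) + cuts φ (reverse xs)      ≡⟨ +-assoc (φ [] xs) _ _ ⟩
    φ [] xs + (φ [] (reverse xs) + cuts φ (reverse xs))    ≡⟨ cong (φ [] xs +_) (splitSum-cuts (reverse xs) φ[]) ⟨
    φ [] xs + splitSum φ [] (reverse xs)                   ≡⟨ +-comm (φ [] xs) _ ⟩
    splitSum φ [] (reverse xs) + φ [] xs                   ≡⟨ cong₂ (λ m ys → m + φ [] ys) (splitSum-cong φ-sym [] (reverse xs)) (sym (reverse-involutive xs)) ⟩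
    splitSum (flip φ) [] (reverse xs) + φ [] (reverse (reverse xs)) ≡⟨ move-left (reverse xs) [] ⟨
    φ (reverse xs) [] + splitSumBefore (reverse xs) []     ≡⟨ cong₂ _+_ (φ-sym (reverse xs) []) (trans (sym (move-right [] xs)) (+-identityʳ _)) ⟩
    φ [] (reverse xs) + splitSum φ [] xs                   ≡⟨ cong (φ [] (reverse xs) +_) (splitSum-cuts xs φ[]) ⟩
    φ [] (reverse xs) + (φ [] xs + cuts φ xs)              ≡⟨ rearrange (φ [] (reverse xs)) (φ [] xs) _ ⟩
    φ [] xs + φ [] (reverse xs) + cuts φ xs                ∎)
    where
    open ≡-Reasoning
    rearrange : ∀ a b c → a + (b + c) ≡ b + a + c
    rearrange = solve-∀

-- For a spine edge with pieces xs and ys: the sides of size k, and the leaves on those sides or on the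
-- sides facing them; part x of a composition carries x - 1 leaves.
sizeHits sameSide otherSide : ℕ → List ℕ → List ℕ → ℕ
sizeHits k xs ys = χ (sum xs ≡ᵇ k) + χ (sum ys ≡ᵇ k)
sameSide k xs ys = leaves xs * χ (sum xs ≡ᵇ k) + leaves ys * χ (sum ys ≡ᵇ k)
otherSide k xs ys = leaves ys * χ (sum xs ≡ᵇ k) + leaves xs * χ (sum ys ≡ᵇ k)

splitSum-sameSide-zero : ∀ {k} ps xs → k < sum ps → ¬ SuffixSum xs k → splitSum (sameSide k) ps xs ≡ 0
splitSum-sameSide-zero ps [] _ _ = refl
splitSum-sameSide-zero {k} ps (x ∷ xs) k<ps ∄
  rewrite ≢⇒≡ᵇ-false (<⇒≢ k<ps ∘ sym)
        | ≢⇒≡ᵇ-false (λ eq → ∄ ([] , x ∷ xs , refl , eq))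
        | *-zeroʳ (leaves ps) | *-zeroʳ (leaves (x ∷ xs))
  = splitSum-sameSide-zero (x ∷ ps) xs (<-≤-trans k<ps (m≤n+m (sum ps) x))
      λ (ps′ , ss , eq , s) → ∄ (x ∷ ps′ , ss , cong (x ∷_) eq , s)

-- Prefix sums of a composition increase strictly, so exactly one cut has a left piece of sum `k`.
-- No right piece has that sum, and the only surviving term is the leaf count of that left piece.
splitSum-sameSide : ∀ {k} ps xs y ys → IsComposition (xs ++ y ∷ ys) → sum ps + sum xs ≡ k →
  ¬ SuffixSum (xs ++ y ∷ ys) k → splitSum (sameSide k) ps (xs ++ y ∷ ys) ≡ leaves ps + leaves xs
splitSum-sameSide {k} ps [] y ys (py ∷ _) eq ∄
  rewrite +-identityʳ (sum ps) | eq | ≡ᵇ-refl k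
        | ≢⇒≡ᵇ-false (λ eq′ → ∄ ([] , y ∷ ys , refl , eq′))
        | *-zeroʳ (leaves (y ∷ ys)) | *-identityʳ (leaves ps)
        | splitSum-sameSide-zero {k} (y ∷ ps) ys
            (subst (_< y + sum ps) eq (m<n+m (sum ps) py))
            (λ (ps′ , ss , eq′ , s) → ∄ (y ∷ ps′ , ss , cong (y ∷_) eq′ , s))
  = +-identityʳ _
splitSum-sameSide {k} ps (x ∷ xs) y ys (px ∷ pxs) eq ∄
  rewrite ≢⇒≡ᵇ-false (<⇒≢ (<-≤-trans (m<m+n (sum ps) (≤-trans px (m≤m+n x (sum xs)))) (≤-reflexive eq)))
        | ≢⇒≡ᵇ-false (λ eq′ → ∄ ([] , x ∷ xs ++ y ∷ ys , refl , eq′))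
        | *-zeroʳ (leaves ps) | *-zeroʳ (leaves (x ∷ xs ++ y ∷ ys))
  = trans (splitSum-sameSide (x ∷ ps) xs y ys pxs (trans (move x (sum ps) _) eq)
             λ (ps′ , ss , eq′ , s) → ∄ (x ∷ ps′ , ss , cong (x ∷_) eq′ , s))
          (move (pred x) (leaves ps) _)
  where
  move : ∀ a b c → a + b + c ≡ b + (a + c)
  move = solve-∀

cuts-sameSide : ∀ {k} xs y ys → 1 ≤ k → IsComposition (xs ++ y ∷ ys) → sum xs ≡ k →
  ¬ SuffixSum (xs ++ y ∷ ys) k → cuts (sameSide k) (xs ++ y ∷ ys) ≡ leaves xs
cuts-sameSide [] y ys (s≤s _) _ () _
cuts-sameSide (x ∷ xs) y ys _ (_ ∷ pxs) eq ∄ = trans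
  (splitSum-sameSide (x ∷ []) xs y ys pxs (trans (cong (_+ sum xs) (+-identityʳ x)) eq)
    λ (ps , ss , eq′ , s) → ∄ (x ∷ ps , ss , cong (x ∷_) eq′ , s))
  (cong (_+ leaves xs) (+-identityʳ (pred x)))

-- Cuts that tell two compositions apart

record Separated (b c : List ℕ) (d g : ℕ) : Set where
  constructor separated
  field
    {xs ys xs′ ys′} : List ℕ
    {y y′}          : ℕ
    left            : b ≡ xs ++ y ∷ ys
    right           : c ≡ xs′ ++ y′ ∷ ys′
    multiple        : ℕ
    size            : sum xs ≡ d + multiple * g
    size′           : sum xs′ ≡ d + multiple * g
    leaves≢         : leaves xs ≢ leaves xs′

separated-sym : ∀ {b c d g} → Separated b c d g → Separated c b d g
separated-sym (separated l r m s s′ ≢) = separated r l m s′ s (≢ ∘ sym)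

separated-++ : ∀ ws {b c d g} n → sum ws ≡ n * g → Separated b c d g → Separated (ws ++ b) (ws ++ c) d g
separated-++ ws {d = d} {g} n eq (separated {xs} {ys} {xs′} {ys′} refl refl m s s′ ≢) =
  separated (sym (++-assoc ws xs _)) (sym (++-assoc ws xs′ _)) (n + m) (size xs s) (size xs′ s′)
    (λ eq′ → ≢ (+-cancelˡ-≡ (leaves ws) _ _ (trans (sym (leaves-++ ws xs)) (trans eq′ (leaves-++ ws xs′)))))
  where
  size : ∀ zs → sum zs ≡ d + m * g → sum (ws ++ zs) ≡ d + (n + m) * g
  size zs eq′ = trans (sum-++ ws zs) (trans (cong₂ _+_ eq eq′) (rearrange n g d m))
    where
    rearrange : ∀ n g d m → n * g + (d + m * g) ≡ d + (n + m) * g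
    rearrange = solve-∀

module _ {p ps r rs} (pγ : IsComposition ((p ∷ ps) ++ r ∷ rs)) where

  private
    γ = (p ∷ ps) ++ r ∷ rs

  -- The nonempty rest `r ∷ rs` shields the prefix: near-concatenation on the right touches only the
  -- last part of `γ`.
  ⊙-starts : ∀ ws → ∃₂ λ y ys → γ ⊙ ws ≡ (p ∷ ps) ++ y ∷ ys
  ⊙-starts [] = r , rs , ⊙-identityʳ γ
  ⊙-starts (w ∷ ws) with y , ys , eq′ ← ∷-⊙-∷ r rs w ws =
    y , ys , trans (∷-++-⊙ (p ∷ ps) r rs (w ∷ ws)) (cong ((p ∷ ps) ++_) eq′)

  ⊙pow-starts : ∀ n ws → 1 ≤ n → ∃₂ λ y ys → ⊙pow n γ ++ ws ≡ (p ∷ ps) ++ y ∷ ys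
  ⊙pow-starts (suc n) ws _ with y , ys , eq ← ⊙-starts (⊙pow n γ) =
    y , ys ++ ws , trans (cong (_++ ws) (trans (⊙pow-suc n γ) eq)) (++-assoc (p ∷ ps) (y ∷ ys) ws)

  -- After `a` copies of `γ`, called `ws`, the first list begins a new block while the second goes
  -- on merging. Cutting both after a further `p ∷ ps` gives `ws ++ (p ∷ ps)` against
  -- `ws ⊙ (p ∷ ps)`: equal sums, one part fewer, hence one leaf more.
  separated-< : ∀ {a b} α β → 1 ≤ a → a < b → IsComposition α → a + sum α ≡ b + sum β →
    Separated ((a ∷ α) ∘c γ) ((b ∷ β) ∘c γ) (sum (p ∷ ps)) (sum γ)
  -- With equal sums the smaller first part cannot be the whole composition.
  separated-< {a} [] β 1≤a a<b pα eq =
    contradiction (<-≤-trans a<b (m≤m+n _ (sum β))) (≤⇒≯ (≤-reflexive (trans (sym eq) (+-identityʳ a))))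
  separated-< {a} (a′ ∷ α) β 1≤a a<b (pa′ ∷ pα) eq
    -- `c` is `b - a - 1`, so the `b` copies split into `a` copies and `suc c` further ones.
    with c , refl ← m≤n⇒∃[o]m+o≡n a<b
    with y , ys , α≡ ← ⊙pow-starts a′ (α ∘c γ) pa′
    with z , zs , γ≡ ← ⊙-starts (⊙pow c γ)
    with ⊙pow a γ in pow≡
  ... | ws = separated
          (trans (cong (ws ++_) α≡) (sym (++-assoc ws (p ∷ ps) (y ∷ ys))))
          β≡ a
          (trans (sum-++ ws (p ∷ ps)) size) (trans (sum-⊙ ws (p ∷ ps)) size)
          leaves≢
    where
    open ≡-Reasoning
    β≡ : ⊙pow (suc (a + c)) γ ++ β ∘c γ ≡ (ws ⊙ (p ∷ ps)) ++ z ∷ zs ++ β ∘c γ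
    β≡ = begin
      ⊙pow (suc (a + c)) γ ++ β ∘c γ             ≡⟨ cong (λ n → ⊙pow n γ ++ β ∘c γ) (+-suc a c) ⟨
      ⊙pow (a + suc c) γ ++ β ∘c γ               ≡⟨ cong (_++ β ∘c γ) (⊙pow-+ a (suc c) γ) ⟩
      (⊙pow a γ ⊙ ⊙pow (suc c) γ) ++ β ∘c γ      ≡⟨ cong (_++ β ∘c γ) (cong₂ _⊙_ pow≡ (trans (⊙pow-suc c γ) γ≡)) ⟩
      (ws ⊙ ((p ∷ ps) ++ z ∷ zs)) ++ β ∘c γ      ≡⟨ cong (_++ β ∘c γ) (⊙-∷-++ ws p ps (z ∷ zs)) ⟩
      ((ws ⊙ (p ∷ ps)) ++ z ∷ zs) ++ β ∘c γ      ≡⟨ ++-assoc (ws ⊙ (p ∷ ps)) (z ∷ zs) _ ⟩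
      (ws ⊙ (p ∷ ps)) ++ z ∷ zs ++ β ∘c γ        ∎
    size : sum ws + sum (p ∷ ps) ≡ sum (p ∷ ps) + a * sum γ
    size = trans (+-comm (sum ws) _) (cong (sum (p ∷ ps) +_) (trans (cong sum (sym pow≡)) (sum-⊙pow a γ)))
    leaves≢ : leaves (ws ++ p ∷ ps) ≢ leaves (ws ⊙ (p ∷ ps))
    leaves≢ eq′ with y , ys , ws≡ ← ⊙pow-starts a [] 1≤a
      with refl ← trans (sym pow≡) (trans (sym (++-identityʳ _)) ws≡) =
      m≢1+m+n (leaves (ws ++ p ∷ ps)) (trans eq′ (trans
        (leaves-⊙ p (ps ++ y ∷ ys) p ps (subst IsComposition pow≡ (⊙pow-composition a pγ)) (All.++⁻ˡ (p ∷ ps) pγ))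
        (cong suc (trans (sym (leaves-++ ws (p ∷ ps))) (sym (+-identityʳ _))))))

  separate : ∀ {α β} → IsComposition α → IsComposition β → sum α ≡ sum β → α ≢ β →
    Separated (α ∘c γ) (β ∘c γ) (sum (p ∷ ps)) (sum γ)
  separate [] [] _ α≢β = contradiction refl α≢β
  separate [] (s≤s _ ∷ _) () _
  separate (s≤s _ ∷ _) [] () _
  separate {a ∷ α} {b ∷ β} (pa ∷ pα) (pb ∷ pβ) eq α≢β with <-cmp a b
  ... | tri< a<b _ _ = separated-< α β pa a<b pα eq
  ... | tri> _ _ b<a = separated-sym (separated-< β α pb b<a pβ (sym eq))
  ... | tri≈ _ refl _ = separated-++ (⊙pow a γ) a (sum-⊙pow a γ)
          (separate pα pβ (+-cancelˡ-≡ a _ _ eq) (α≢β ∘ cong (a ∷_)))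

-- Recovering the same-side counts by induction on the size

sides : ∀ k xs ys → sameSide k xs ys + otherSide k xs ys ≡ (leaves xs + leaves ys) * sizeHits k xs ys
sides k xs ys = expand (leaves xs) (leaves ys) (χ (sum xs ≡ᵇ k)) (χ (sum ys ≡ᵇ k))
  where
  expand : ∀ a b s t → (a * s + b * t) + (b * s + a * t) ≡ (a + b) * (s + t)
  expand = solve-∀

splitSum-sides : ∀ k ps xs →
  splitSum (λ ys zs → sameSide k ys zs + otherSide k ys zs) ps xs ≡ (leaves ps + leaves xs) * splitSum (sizeHits k) ps xs
splitSum-sides k ps [] = sym (*-zeroʳ (leaves ps + 0))
splitSum-sides k ps (x ∷ xs) = begin
  sameSide k ps (x ∷ xs) + otherSide k ps (x ∷ xs) + splitSum (λ ys zs → sameSide k ys zs + otherSide k ys zs) (x ∷ ps) xs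
    ≡⟨ cong₂ _+_ (sides k ps (x ∷ xs)) (splitSum-sides k (x ∷ ps) xs) ⟩
  (leaves ps + leaves (x ∷ xs)) * sizeHits k ps (x ∷ xs) + (pred x + leaves ps + leaves xs) * splitSum (sizeHits k) (x ∷ ps) xs
    ≡⟨ factor (leaves ps) (pred x) (leaves xs) _ _ ⟩
  (leaves ps + leaves (x ∷ xs)) * (sizeHits k ps (x ∷ xs) + splitSum (sizeHits k) (x ∷ ps) xs) ∎
  where
  open ≡-Reasoning
  factor : ∀ a b c s t → (a + (b + c)) * s + (b + a + c) * t ≡ (a + (b + c)) * (s + t)
  factor = solve-∀

cuts-sides : ∀ k b → cuts (sameSide k) b + cuts (otherSide k) b ≡ leaves b * cuts (sizeHits k) b
cuts-sides k [] = refl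
cuts-sides k (x ∷ xs) = begin
  splitSum (sameSide k) (x ∷ []) xs + splitSum (otherSide k) (x ∷ []) xs   ≡⟨ splitSum-+ (sameSide k) (otherSide k) (x ∷ []) xs ⟨
  splitSum (λ ys zs → sameSide k ys zs + otherSide k ys zs) (x ∷ []) xs    ≡⟨ splitSum-sides k (x ∷ []) xs ⟩
  (pred x + 0 + leaves xs) * splitSum (sizeHits k) (x ∷ []) xs            ≡⟨ cong (λ m → (m + leaves xs) * splitSum (sizeHits k) (x ∷ []) xs) (+-identityʳ (pred x)) ⟩
  (pred x + leaves xs) * splitSum (sizeHits k) (x ∷ []) xs                ∎
  where open ≡-Reasoning

-- A side of size two consists of an end of the spine and its only leaf.
leaves-of-two : ∀ x xs → All (2 ≤_) (x ∷ xs) → leaves (x ∷ xs) * χ (sum (x ∷ xs) ≡ᵇ 2) ≡ χ (sum (x ∷ xs) ≡ᵇ 2)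
leaves-of-two 2 [] _ = refl
leaves-of-two (suc (suc (suc x))) xs _ = *-zeroʳ (suc (suc x) + leaves xs)
leaves-of-two 0 xs (() ∷ _)
leaves-of-two 1 xs (s≤s () ∷ _)
leaves-of-two 2 (suc x ∷ xs) _ = *-zeroʳ (1 + (x + leaves xs))
leaves-of-two 2 (zero ∷ xs) (_ ∷ () ∷ _)

splitSum-two : ∀ p ps xs → All (2 ≤_) (p ∷ ps) → All (2 ≤_) xs →
  splitSum (sameSide 2) (p ∷ ps) xs ≡ splitSum (sizeHits 2) (p ∷ ps) xs
splitSum-two p ps [] _ _ = refl
splitSum-two p ps (x ∷ xs) 2≤p (2≤x ∷ 2≤xs) = cong₂ _+_
  (cong₂ _+_ (leaves-of-two p ps 2≤p) (leaves-of-two x xs (2≤x ∷ 2≤xs)))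
  (splitSum-two x (p ∷ ps) xs (2≤x ∷ 2≤p) 2≤xs)

cuts-two : ∀ {b} → All (2 ≤_) b → cuts (sameSide 2) b ≡ cuts (sizeHits 2) b
cuts-two [] = refl
cuts-two {x ∷ xs} (2≤x ∷ 2≤xs) = splitSum-two x [] xs (2≤x ∷ []) 2≤xs

-- Subtraction is expressed by cancellation: first of `sameSide k` from the two-sided total, then of
-- `otherSide k` from the mixed equation. The step to `suc k` uses the mixed equation at `k`, whose
-- upper bound is exactly that of the conclusion at `suc k`.
sameSide-determined : ∀ {b c} → All (2 ≤_) b → All (2 ≤_) c →
  leaves b ≡ leaves c →
  (∀ k → cuts (sizeHits k) b ≡ cuts (sizeHits k) c) →
  (∀ k → 2 ≤ k → suc (suc k) < sum b →
    cuts (sameSide (suc k)) b + cuts (otherSide k) b ≡ cuts (sameSide (suc k)) c + cuts (otherSide k) c) →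
  ∀ k → 2 ≤ k → suc k < sum b → cuts (sameSide k) b ≡ cuts (sameSide k) c
sameSide-determined {b} {c} 2≤b 2≤c leaves≡ hits≡ mixed≡ = go
  where
  step : ∀ k → 2 ≤ k → suc (suc k) < sum b → cuts (sameSide k) b ≡ cuts (sameSide k) c →
    cuts (sameSide (suc k)) b ≡ cuts (sameSide (suc k)) c
  step k 2≤k k< same≡ = +-cancelʳ-≡ (cuts (otherSide k) b) _ _ (trans
    (mixed≡ k 2≤k k<)
    (cong (cuts (sameSide (suc k)) c +_) (sym other≡)))
    where
    other≡ : cuts (otherSide k) b ≡ cuts (otherSide k) c
    other≡ = +-cancelˡ-≡ (cuts (sameSide k) b) _ _ (trans (cuts-sides k b)
      (trans (cong₂ _*_ leaves≡ (hits≡ k))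
      (trans (sym (cuts-sides k c)) (cong (_+ cuts (otherSide k) c) (sym same≡)))))
  go : ∀ k → 2 ≤ k → suc k < sum b → cuts (sameSide k) b ≡ cuts (sameSide k) c
  go 1 (s≤s ()) _
  go 2 _ _ = trans (cuts-two 2≤b) (trans (hits≡ 2) (sym (cuts-two 2≤c)))
  go (suc (suc (suc m))) _ k< = step (suc (suc m)) 2≤ k< (go (suc (suc m)) 2≤ (≤-trans (n≤1+n _) k<))
    where
    2≤ : 2 ≤ suc (suc m)
    2≤ = s≤s (s≤s z≤n)

-- Distinguishing compositions by their same-side counts

sameSide-reverse : ∀ k {b} c → b ≡ c ⊎ b ≡ reverse c → 1 ≤ k → cuts (sameSide k) b ≡ cuts (sameSide k) c
sameSide-reverse k c (inj₁ refl) _ = refl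
sameSide-reverse (suc k) c (inj₂ refl) _ =
  cuts-reverse (sameSide (suc k)) (λ xs ys → +-comm (leaves xs * _) _) refl c

2≤sum : ∀ {xs} → All (2 ≤_) xs → 1 ≤ sum xs → 2 ≤ sum xs
2≤sum (2≤x ∷ _) _ = m≤n⇒m≤n+o _ 2≤x

All-reverse : ∀ {P : ℕ → Set} {b} c → b ≡ c ⊎ b ≡ reverse c → All P b → All P c
All-reverse c (inj₁ refl) pb = pb
All-reverse c (inj₂ refl) pb = All-resp-↭ (↭-reverse c) pb

sum-of-reverse : ∀ {b} c → b ≡ c ⊎ b ≡ reverse c → sum b ≡ sum c
sum-of-reverse c (inj₁ refl) = refl
sum-of-reverse c (inj₂ refl) = sum-reverse c

-- A suffix sum of the product is `e + q * sum γ` with `e` a suffix sum of `γ`, and comparing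
-- residues forces `e` to be `d`.
not-suffixSum : ∀ {γ d} j → ¬ SuffixSum γ d → 1 ≤ d → d < sum γ → ∀ α → ¬ SuffixSum (α ∘c γ) (d + j * sum γ)
not-suffixSum {γ} j ∄ 1≤d d<g α s with suffixSum-∘c α γ s
... | q , e , (ps , ss , eq , refl) , eq′ =
  ∄ (ps , ss , eq , remainder-unique q j
      (subst (λ zs → sum ss ≤ sum zs) (sym eq) (subst (sum ss ≤_) (sym (sum-++ ps ss)) (m≤n+m (sum ss) (sum ps))))
      1≤d d<g (sym eq′))

sameSide-distinguishes : ∀ {α β γ b c} → IsComposition α → IsComposition β → IsComposition γ →
  sum α ≡ sum β → reverse γ ≢ γ → α ≢ β →
  b ≡ α ∘c γ ⊎ b ≡ reverse (α ∘c γ) → c ≡ β ∘c γ ⊎ c ≡ reverse (β ∘c γ) →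
  All (2 ≤_) b → All (2 ≤_) c →
  ¬ (∀ k → 2 ≤ k → suc k < sum b → cuts (sameSide k) b ≡ cuts (sameSide k) c)
sameSide-distinguishes {α} {β} {γ} {b} {c} pα pβ pγ sum≡ γ≢ α≢β b≡ c≡ 2≤b 2≤c same≡
  with non-palindrome-escapes pγ γ≢
-- The escaping prefix is neither empty nor all of `γ`, since both of these are suffixes too.
... | [] , rs , refl , esc = esc (rs , [] , sym (++-identityʳ rs) , refl)
... | p ∷ ps , [] , refl , esc = esc ([] , p ∷ ps , ++-identityʳ _ , refl)
... | p ∷ ps , r ∷ rs , refl , esc
  with separated {xs} {ys} {xs′} {ys′} {y} {y′} l≡ r≡ j size size′ leaves≢ ← separate pγ pα pβ sum≡ α≢β =
  leaves≢ (begin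
    leaves xs                         ≡⟨ value α xs y ys pα l≡ size ⟨
    cuts (sameSide k) (α ∘c γ)        ≡⟨ sameSide-reverse k (α ∘c γ) b≡ 1≤k ⟨
    cuts (sameSide k) b               ≡⟨ same≡ k 2≤k k< ⟩
    cuts (sameSide k) c               ≡⟨ sameSide-reverse k (β ∘c γ) c≡ 1≤k ⟩
    cuts (sameSide k) (β ∘c γ)        ≡⟨ value β xs′ y′ ys′ pβ r≡ size′ ⟩
    leaves xs′                        ∎)
  where
  open ≡-Reasoning
  d = sum (p ∷ ps)
  k = d + j * sum γ
  1≤d : 1 ≤ d
  1≤d = ≤-trans (All.head pγ) (m≤m+n p _)
  1≤k : 1 ≤ k
  1≤k = ≤-trans 1≤d (m≤m+n d _)
  d<g : d < sum γ
  d<g = subst (d <_) (sym (sum-++ (p ∷ ps) (r ∷ rs)))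
    (m<m+n d (≤-trans (All.head (All.++⁻ʳ (p ∷ ps) pγ)) (m≤m+n r _)))
  2≤α : All (2 ≤_) (xs ++ y ∷ ys)
  2≤α = subst (All (2 ≤_)) l≡ (All-reverse (α ∘c γ) b≡ 2≤b)
  -- Parts of a spine sequence are at least 2. The left piece is nonempty, which gives this bound;
  -- the right piece is nonempty too, which gives `k + 2 ≤ sum b` below.
  2≤k : 2 ≤ k
  2≤k = subst (2 ≤_) size (2≤sum (All.++⁻ˡ xs 2≤α) (subst (1 ≤_) (sym size) 1≤k))
  k< : suc k < sum b
  k< = subst (suc k <_) (sym (trans (sum-of-reverse (α ∘c γ) b≡) (trans (cong sum l≡) (sum-++ xs (y ∷ ys)))))
    (subst (λ z → suc (suc k) ≤ z + sum (y ∷ ys)) (sym size)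
      (subst (_≤ k + sum (y ∷ ys)) (+-comm k 2) (+-monoʳ-≤ k (m≤n⇒m≤n+o _ (All.head (All.++⁻ʳ xs 2≤α))))))
  compositions : ∀ δ → IsComposition δ → IsComposition (δ ∘c γ)
  compositions [] _ = []
  compositions (a ∷ δ) (_ ∷ pδ) = All.++⁺ (⊙pow-composition a pγ) (compositions δ pδ)
  value : ∀ δ zs z zs′ → IsComposition δ → δ ∘c γ ≡ zs ++ z ∷ zs′ → sum zs ≡ k → cuts (sameSide k) (δ ∘c γ) ≡ leaves zs
  value δ zs z zs′ pδ eq sum-zs = trans (cong (cuts (sameSide k)) eq)
    (cuts-sameSide zs z zs′ 1≤k (subst IsComposition eq (compositions δ pδ)) sum-zs
      (subst (λ ws → ¬ SuffixSum ws k) eq (not-suffixSum j esc 1≤d d<g δ)))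

-- Finite sums and counting

private
  variable
    A B : Set
    n : ℕ

∑ : List A → (A → ℕ) → ℕ
∑ xs f = sum (map f xs)

∑-cong-∈ : ∀ (xs : List A) {f g : A → ℕ} → (∀ {x} → x ∈ xs → f x ≡ g x) → ∑ xs f ≡ ∑ xs g
∑-cong-∈ [] eq = refl
∑-cong-∈ (x ∷ xs) eq = cong₂ _+_ (eq (here refl)) (∑-cong-∈ xs (eq ∘ there))

∑-cong : ∀ (xs : List A) {f g : A → ℕ} → (∀ x → f x ≡ g x) → ∑ xs f ≡ ∑ xs g
∑-cong xs eq = ∑-cong-∈ xs (λ {x} _ → eq x)

∑-zero : ∀ (xs : List A) → ∑ xs (λ _ → 0) ≡ 0
∑-zero [] = refl
∑-zero (x ∷ xs) = ∑-zero xs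

∑-+ : ∀ (xs : List A) (f g : A → ℕ) → ∑ xs (λ x → f x + g x) ≡ ∑ xs f + ∑ xs g
∑-+ [] f g = refl
∑-+ (x ∷ xs) f g = trans (cong (f x + g x +_) (∑-+ xs f g)) (interchange (f x) (g x) _ _)
  where
  interchange : ∀ a b c d → a + b + (c + d) ≡ a + c + (b + d)
  interchange = solve-∀

∑-*ʳ : ∀ (xs : List A) (f : A → ℕ) c → ∑ xs (λ x → f x * c) ≡ ∑ xs f * c
∑-*ʳ [] f c = refl
∑-*ʳ (x ∷ xs) f c = trans (cong (f x * c +_) (∑-*ʳ xs f c)) (sym (*-distribʳ-+ c (f x) _))

∑-++ : ∀ (xs ys : List A) (f : A → ℕ) → ∑ (xs ++ ys) f ≡ ∑ xs f + ∑ ys f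
∑-++ xs ys f = trans (cong sum (map-++ f xs ys)) (sum-++ (map f xs) _)

∑-map : ∀ (h : B → A) xs (f : A → ℕ) → ∑ (map h xs) f ≡ ∑ xs (f ∘ h)
∑-map h xs f = cong sum (sym (map-∘ xs))

∑-↭ : ∀ {xs ys : List A} (f : A → ℕ) → xs ↭ ys → ∑ xs f ≡ ∑ ys f
∑-↭ f σ = sum-↭ (map⁺ f σ)

∑-swap : ∀ (xs : List A) (ys : List B) (f : A → B → ℕ) →
  ∑ xs (λ x → ∑ ys (f x)) ≡ ∑ ys (λ y → ∑ xs (λ x → f x y))
∑-swap [] ys f = sym (∑-zero ys)
∑-swap (x ∷ xs) ys f = trans (cong (∑ ys (f x) +_) (∑-swap xs ys f)) (sym (∑-+ ys (f x) _))

∑-mono-≤ : ∀ (xs : List A) {f g : A → ℕ} → (∀ x → f x ≤ g x) → ∑ xs f ≤ ∑ xs g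
∑-mono-≤ [] f≤g = z≤n
∑-mono-≤ (x ∷ xs) f≤g = +-mono-≤ (f≤g x) (∑-mono-≤ xs f≤g)

∑-mono-< : ∀ {xs : List A} {f g : A → ℕ} {x} → (∀ x → f x ≤ g x) → x ∈ xs → f x < g x → ∑ xs f < ∑ xs g
∑-mono-< {xs = x ∷ xs} f≤g (here refl) f<g = +-mono-<-≤ f<g (∑-mono-≤ xs f≤g)
∑-mono-< {xs = x ∷ xs} f≤g (there x∈) f<g = +-mono-≤-< (f≤g x) (∑-mono-< f≤g x∈ f<g)

count≡∑ : ∀ (P : A → Bool) xs → count P xs ≡ ∑ xs (χ ∘ P)
count≡∑ P [] = refl
count≡∑ P (x ∷ xs) with P x
... | true = cong suc (count≡∑ P xs)
... | false = count≡∑ P xs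

count-map : ∀ (P : A → Bool) (h : B → A) xs → count P (map h xs) ≡ count (P ∘ h) xs
count-map P h [] = refl
count-map P h (x ∷ xs) with P (h x)
... | true = cong suc (count-map P h xs)
... | false = count-map P h xs

count-↭ : ∀ (P : A → Bool) {xs ys} → xs ↭ ys → count P xs ≡ count P ys
count-↭ P {xs} {ys} σ = trans (count≡∑ P xs) (trans (∑-↭ (χ ∘ P) σ) (sym (count≡∑ P ys)))

count-≤-length : ∀ (P : A → Bool) xs → count P xs ≤ length xs
count-≤-length P xs = length-filter (T? ∘ P) xs

module _ (_≟_ : DecidableEquality A) where

  count>0⇒∈ : ∀ x ys {m} → count (λ y → does (y ≟ x)) ys ≡ suc m → x ∈ ys
  count>0⇒∈ x (y ∷ ys) eq with y ≟ x
  ... | yes y≡x = here (sym y≡x)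
  ... | no _ = there (count>0⇒∈ x ys eq)

  count-self : ∀ x xs → count (λ y → does (y ≟ x)) (x ∷ xs) ≡ suc (count (λ y → does (y ≟ x)) xs)
  count-self x xs with x ≟ x
  ... | yes _ = refl
  ... | no x≢x = contradiction refl x≢x

  -- The head of the first list has a positive count, so it occurs in the second; striking it from
  -- both keeps all counts equal. Equality of the coefficients `U` is just such an equality of
  -- multiplicities.
  counts⇒↭ : ∀ xs ys → (∀ z → count (λ y → does (y ≟ z)) xs ≡ count (λ y → does (y ≟ z)) ys) → xs ↭ ys
  counts⇒↭ [] [] eq = ↭-refl
  counts⇒↭ [] (y ∷ ys) eq = contradiction (trans (eq y) (count-self y ys)) λ ()
  counts⇒↭ (x ∷ xs) ys eq
    with us , vs , refl ← ∈-∃++ (count>0⇒∈ x ys (trans (sym (eq x)) (count-self x xs))) =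
    ↭-trans (↭.prep x (counts⇒↭ xs (us ++ vs) eq′)) (↭-sym (shift x us vs))
    where
    strip : ∀ z ws ws′ → count (λ y → does (y ≟ z)) (x ∷ ws) ≡ count (λ y → does (y ≟ z)) (x ∷ ws′) →
      count (λ y → does (y ≟ z)) ws ≡ count (λ y → does (y ≟ z)) ws′
    strip z ws ws′ eq with x ≟ z
    ... | yes _ = suc-injective eq
    ... | no _ = eq
    eq′ : ∀ z → count (λ y → does (y ≟ z)) xs ≡ count (λ y → does (y ≟ z)) (us ++ vs)
    eq′ z = strip z xs (us ++ vs) (trans (eq z) (count-↭ _ (shift x us vs)))

-- Sums over the subsets of a list, indexed by the elements left out

∑removed : List A → (List A → ℕ) → ℕ
∑removed [] G = G []
∑removed (x ∷ xs) G = ∑removed xs (G ∘ (x ∷_)) + ∑removed xs G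

-- The relevant edge sets omit very few edges, so they are best described by what they omit. The
-- interleaving records that kept and omitted elements together make up `xs`, which the comparison
-- of `λpart` with a labelling requires.
∑-subsets : ∀ (xs : List A) (H G : List A → ℕ) → (∀ {ls rs} → Interleaving ls rs xs → H ls ≡ G rs) →
  ∑ (subsets xs) H ≡ ∑removed xs G
∑-subsets [] H G eq = trans (+-identityʳ _) (eq [])
∑-subsets (x ∷ xs) H G eq = begin
  ∑ (subsets xs ++ map (x ∷_) (subsets xs)) H              ≡⟨ ∑-++ (subsets xs) _ H ⟩
  ∑ (subsets xs) H + ∑ (map (x ∷_) (subsets xs)) H         ≡⟨ cong (∑ (subsets xs) H +_) (∑-map (x ∷_) (subsets xs) H) ⟩
  ∑ (subsets xs) H + ∑ (subsets xs) (H ∘ (x ∷_))           ≡⟨ cong₂ _+_ (∑-subsets xs H (G ∘ (x ∷_)) (eq ∘ consʳ))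
                                                                        (∑-subsets xs (H ∘ (x ∷_)) G (eq ∘ consˡ)) ⟩
  ∑removed xs (G ∘ (x ∷_)) + ∑removed xs G                 ∎
  where open ≡-Reasoning

∑removed-∅ : ∀ xs {G : List A → ℕ} → (∀ y ys → G (y ∷ ys) ≡ 0) → ∑removed xs G ≡ G []
∑removed-∅ [] G0 = refl
∑removed-∅ (x ∷ xs) G0 = cong₂ _+_ (trans (∑removed-∅ xs λ y ys → G0 x (y ∷ ys)) (G0 x [])) (∑removed-∅ xs G0)

-- A statistic that demands two parts vanishes unless exactly one edge of the tree is removed, and
-- the sum over subsets collapses to a sum over edges.
∑removed-one : ∀ xs {G : List A → ℕ} → G [] ≡ 0 → (∀ y z zs → G (y ∷ z ∷ zs) ≡ 0) →
  ∑removed xs G ≡ ∑ xs (λ x → G (x ∷ []))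
∑removed-one [] G0 G2 = G0
∑removed-one (x ∷ xs) G0 G2 = cong₂ _+_ (∑removed-∅ xs (G2 x)) (∑removed-one xs G0 G2)

∑pairs : List A → (A → A → ℕ) → ℕ
∑pairs [] f = 0
∑pairs (x ∷ xs) f = ∑ xs (f x) + ∑pairs xs f

∑removed-two : ∀ xs {G : List A → ℕ} → G [] ≡ 0 → (∀ y → G (y ∷ []) ≡ 0) → (∀ x y z zs → G (x ∷ y ∷ z ∷ zs) ≡ 0) →
  ∑removed xs G ≡ ∑pairs xs (λ x y → G (x ∷ y ∷ []))
∑removed-two [] G0 G1 G3 = G0
∑removed-two (x ∷ xs) G0 G1 G3 = cong₂ _+_ (∑removed-one xs (G1 x) (G3 x)) (∑removed-two xs G0 G1 G3)

∑pairs-map : ∀ (h : B → A) xs f → ∑pairs (map h xs) f ≡ ∑pairs xs (λ x y → f (h x) (h y))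
∑pairs-map h [] f = refl
∑pairs-map h (x ∷ xs) f = cong₂ _+_ (∑-map h xs (f (h x))) (∑pairs-map h xs f)

-- A permutation may exchange the two members of a pair, which a symmetric `f` does not notice. This
-- allows the leaf edges to be listed before the spine edges.
∑pairs-↭ : ∀ {xs ys} (f : A → A → ℕ) → (∀ x y → f x y ≡ f y x) → xs ↭ ys → ∑pairs xs f ≡ ∑pairs ys f
∑pairs-↭ f f-sym ↭.refl = refl
∑pairs-↭ f f-sym (↭.prep x σ) = cong₂ _+_ (∑-↭ (f x) σ) (∑pairs-↭ f f-sym σ)
∑pairs-↭ f f-sym (↭.swap {xs = xs} {ys = ys} x y σ) = trans
  (cong₂ (λ m n → f x y + m + n) (∑-↭ (f x) σ) (cong₂ _+_ (∑-↭ (f y) σ) (∑pairs-↭ f f-sym σ)))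
  (trans (rearrange (f x y) (∑ ys (f x)) (∑ ys (f y)) (∑pairs ys f)) (cong (λ m → m + ∑ ys (f y) + (∑ ys (f x) + ∑pairs ys f)) (f-sym x y)))
  where
  rearrange : ∀ a b c d → a + b + (c + d) ≡ a + c + (b + d)
  rearrange = solve-∀
∑pairs-↭ f f-sym (↭.trans σ τ) = trans (∑pairs-↭ f f-sym σ) (∑pairs-↭ f f-sym τ)

∑pairs-++ : ∀ (xs ys : List A) f → ∑pairs (xs ++ ys) f ≡ ∑pairs xs f + ∑ xs (λ x → ∑ ys (f x)) + ∑pairs ys f
∑pairs-++ [] ys f = refl
∑pairs-++ (x ∷ xs) ys f = trans (cong₂ _+_ (∑-++ xs ys (f x)) (∑pairs-++ xs ys f))
  (rearrange (∑ xs (f x)) (∑ ys (f x)) (∑pairs xs f) _ _)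
  where
  rearrange : ∀ a b c d e → a + b + (c + d + e) ≡ a + c + (b + d) + e
  rearrange = solve-∀

∑pairs-zero : ∀ {xs : List A} {f} → Unique xs → (∀ {x y} → x ∈ xs → y ∈ xs → x ≢ y → f x y ≡ 0) → ∑pairs xs f ≡ 0
∑pairs-zero [] f0 = refl
∑pairs-zero {xs = x ∷ xs} (x≢ ∷ u) f0 = cong₂ _+_
  (trans (∑-cong-∈ xs λ y∈ → f0 (here refl) (there y∈) (All.lookup x≢ y∈)) (∑-zero xs))
  (∑pairs-zero u λ x∈ y∈ → f0 (there x∈) (there y∈))

χ-mono : ∀ {a b} → (T a → T b) → χ a ≤ χ b
χ-mono {false} _ = z≤n
χ-mono {true} {true} _ = s≤s z≤n
χ-mono {true} {false} a⇒b with () ← a⇒b _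

χ-cong : ∀ {a b} → (T a → T b) → (T b → T a) → χ a ≡ χ b
χ-cong a⇒b b⇒a = ≤-antisym (χ-mono a⇒b) (χ-mono b⇒a)

χ-< : ∀ {a b} → ¬ T a → T b → χ a < χ b
χ-< {false} {true} _ _ = s≤s z≤n
χ-< {true} ¬a _ = contradiction _ ¬a

unique-map : ∀ {A B : Set} {f : A → B} {xs} → (∀ {x y} → x ∈ xs → y ∈ xs → f x ≡ f y → x ≡ y) →
  Unique xs → Unique (map f xs)
unique-map inj [] = []
unique-map {f = f} inj (x≢ ∷ u) =
  All.map⁺ (All.tabulate λ y∈ eq → All.lookup x≢ y∈ (inj (here refl) (there y∈) eq))
  ∷ unique-map (λ x∈ y∈ → inj (there x∈) (there y∈)) u

does-≟⇒≡ : ∀ {u v : Fin n} → T (does (u Fin.≟ v)) → u ≡ v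
does-≟⇒≡ {u = u} {v} t with u Fin.≟ v
... | yes eq = eq

eqF⇒≡ : ∀ {u v : Fin n} → T (eqF u v) → u ≡ v
eqF⇒≡ {u = u} {v} = Fin.toℕ-injective ∘ ≡ᵇ⇒≡ (toℕ u) (toℕ v)

eqF-refl : ∀ (u : Fin n) → T (eqF u u)
eqF-refl u = ≡⇒≡ᵇ (toℕ u) (toℕ u) refl

-- Components by iterated reachability

stepR-⇔ : ∀ (A : List (Edge n)) S v → T (stepR A S v) ⇔ (T (S v) ⊎ ∃ λ w → T (S w) × Adj A w v)
stepR-⇔ {n} A S v = mk⇔ fwd bwd
  where
  fwd : T (stepR A S v) → T (S v) ⊎ ∃ λ w → T (S w) × Adj A w v
  fwd t with to T-∨ t
  ... | inj₁ s = inj₁ s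
  ... | inj₂ s with w , sw ← Any.satisfied (Any.any⁻ _ (allFin n) s) = inj₂ (w , to T-∧ sw)
  bwd : T (S v) ⊎ (∃ λ w → T (S w) × Adj A w v) → T (stepR A S v)
  bwd (inj₁ s) = from T-∨ (inj₁ s)
  bwd (inj₂ (w , sw , a)) = from (T-∨ {S v}) (inj₂ (Any.any⁺ _ (Any.map (λ { refl → from T-∧ (sw , a) }) (∈-allFin w))))

module _ {n} (A : List (Edge n)) (S : Fin n → Bool) where

  Stable : ℕ → Set
  Stable k = ∀ v → T (stepR A (iterR k A S) v) → T (iterR k A S v)

  stable-suc : ∀ k → Stable k → Stable (suc k)
  stable-suc k stable v t with to (stepR-⇔ A (iterR (suc k) A S) v) t
  ... | inj₁ s = s
  ... | inj₂ (w , sw , a) = from (stepR-⇔ A (iterR k A S) v) (inj₂ (w , stable w sw , a))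

  -- Until the set is closed under adjacency it gains a vertex at every step, so an unstable set has
  -- more than `k` members after `k` steps. At `k = n` only stability remains.
  stable-or-grows : 1 ≤ count S (allFin n) → ∀ k → Stable k ⊎ k < count (iterR k A S) (allFin n)
  stable-or-grows 1≤ zero = inj₂ 1≤
  stable-or-grows 1≤ (suc k) with stable-or-grows 1≤ k
  ... | inj₁ stable = inj₁ (stable-suc k stable)
  ... | inj₂ k< with Fin.any? (λ v → T? (iterR (suc k) A S v) ×-dec ¬? (T? (iterR k A S v)))
  ...   | yes (v , new , ¬old) = inj₂ (≤-<-trans k<
    (subst₂ _<_ (sym (count≡∑ (iterR k A S) (allFin n))) (sym (count≡∑ (iterR (suc k) A S) (allFin n)))
      (∑-mono-< (λ w → χ-mono (λ s → from (stepR-⇔ A (iterR k A S) w) (inj₁ s))) (∈-allFin v) (χ-< ¬old new))))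
  ...   | no ∄ = inj₁ (stable-suc k λ v t → decidable v t (T? (iterR k A S v)))
    where
    decidable : ∀ v → T (iterR (suc k) A S v) → Dec (T (iterR k A S v)) → T (iterR k A S v)
    decidable v t (yes s) = s
    decidable v t (no ¬s) = contradiction (v , t , ¬s) ∄

  iterR-stable : 1 ≤ count S (allFin n) → Stable n
  iterR-stable 1≤ with stable-or-grows 1≤ n
  ... | inj₁ stable = stable
  ... | inj₂ n< = contradiction (≤-trans n< (≤-trans (count-≤-length (iterR n A S) (allFin n))
                    (≤-reflexive (length-tabulate (λ i → i))))) (<-irrefl refl)

  iterR-⊇ : ∀ k v → T (S v) → T (iterR k A S v)
  iterR-⊇ zero v s = s
  iterR-⊇ (suc k) v s = from (stepR-⇔ A (iterR k A S) v) (inj₁ (iterR-⊇ k v s))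

  iterR-induction : (P : Fin n → Set) → (∀ v → T (S v) → P v) → (∀ w v → P w → Adj A w v → P v) →
    ∀ k v → T (iterR k A S v) → P v
  iterR-induction P base step zero v s = base v s
  iterR-induction P base step (suc k) v t with to (stepR-⇔ A (iterR k A S) v) t
  ... | inj₁ s = iterR-induction P base step k v s
  ... | inj₂ (w , sw , a) = step w v (iterR-induction P base step k w sw) a

module _ {n} (A : List (Edge n)) where

  compOf-refl : ∀ u → T (compOf A u u)
  compOf-refl u = iterR-⊇ A (eqF u) n u (eqF-refl u)

  compOf-closed : ∀ u {w v} → T (compOf A u w) → Adj A w v → T (compOf A u v)
  compOf-closed u {w} {v} s a = iterR-stable A (eqF u) nonempty v (from (stepR-⇔ A _ v) (inj₂ (w , s , a)))
    where
    nonempty : 1 ≤ count (eqF u) (allFin n)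
    nonempty = subst₂ _<_ (∑-zero (allFin n)) (sym (count≡∑ (eqF u) (allFin n)))
      (∑-mono-< (λ _ → z≤n) (∈-allFin u) (χ-< {false} (λ ()) (eqF-refl u)))

  compOf-invariant : ∀ {B : Set} (f : Fin n → B) → (∀ w v → Adj A w v → f w ≡ f v) →
    ∀ {u v} → T (compOf A u v) → f u ≡ f v
  compOf-invariant f f-adj {u} {v} = iterR-induction A (eqF u) (λ w → f u ≡ f w)
    (λ w u≡w → cong f (eqF⇒≡ u≡w)) (λ w v eq a → trans eq (f-adj w v a)) n v

-- The partition λ(A) from a labelling of the vertices by representatives of the components

module Labelled {n} (A : List (Edge n)) (label : Fin n → Fin n) (labels : List (Fin n))
  (label-idem : ∀ {x} → x ∈ labels → label x ≡ x)
  (label-∈ : ∀ v → label v ∈ labels)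
  (labels-unique : Unique labels)
  (compOf-label : ∀ u v → T (compOf A u v) ⇔ (label u ≡ label v))
  where

  labelSize : Fin n → ℕ
  labelSize x = count (λ v → does (label v Fin.≟ x)) (allFin n)

  private
    isRep⇒minimal : ∀ {u v} → T (isRep A u) → label u ≡ label v → toℕ u ≤ toℕ v
    isRep⇒minimal {u} {v} rep eq with toℕ u ≤? toℕ v
    ... | yes u≤v = u≤v
    ... | no u≰v = contradiction rep (subst (λ b → ¬ T (not b)) (sym (to T-≡ some)) (λ ()))
      where
      some : T (any (λ w → compOf A u w ∧ (toℕ w <ᵇ toℕ u)) (allFin n))
      some = Any.any⁺ _ (Any.map (λ { refl → from T-∧ (from (compOf-label u v) eq , <⇒<ᵇ (≰⇒> u≰v)) }) (∈-allFin v))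

    -- Descent on vertex numbers: a vertex that is not least in its component has a smaller one
    -- there.
    representative : ∀ u → Acc _<_ (toℕ u) → ∃ λ v → T (isRep A v) × label v ≡ label u
    representative u (acc rs) with T? (any (λ w → compOf A u w ∧ (toℕ w <ᵇ toℕ u)) (allFin n))
    ... | no ¬t = u , minimal ¬t , refl
      where
      minimal : ∀ {b} → ¬ T b → T (not b)
      minimal {false} _ = _
      minimal {true} ¬t = contradiction _ ¬t
    ... | yes t with w , tw ← Any.satisfied (Any.any⁻ _ (allFin n) t)
        with c , w<u ← to T-∧ tw
        with v , rep , eq ← representative w (rs (<ᵇ⇒< (toℕ w) (toℕ u) w<u)) =
        v , rep , trans eq (sym (to (compOf-label u w) c))

    reps : List (Fin n)
    reps = filterᵇ (isRep A) (allFin n)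

    reps-unique : Unique (map label reps)
    reps-unique = unique-map (λ u∈ v∈ eq → Fin.toℕ-injective (≤-antisym
        (isRep⇒minimal (rep u∈) eq) (isRep⇒minimal (rep v∈) (sym eq))))
      (Unique.filter⁺ (T? ∘ isRep A) (Unique.allFin⁺ n))
      where
      rep : ∀ {u} → u ∈ reps → T (isRep A u)
      rep u∈ = proj₂ (∈-filter⁻ (T? ∘ isRep A) {xs = allFin n} u∈)

    -- Least vertices and labels both select one vertex per component, and duplicate-free lists with
    -- the same members are permutations of each other.
    reps-labels : map label reps ↭ labels
    reps-labels = ∼bag⇒↭ (unique∧set⇒bag reps-unique labels-unique (mk⇔ fwd bwd))
      where
      fwd : ∀ {x} → x ∈ map label reps → x ∈ labels
      fwd x∈ with v , _ , refl ← ∈-map⁻ label x∈ = label-∈ v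
      bwd : ∀ {x} → x ∈ labels → x ∈ map label reps
      bwd {x} x∈ with v , rep , eq ← representative x (<-wellFounded (toℕ x)) =
        subst (_∈ map label reps) (trans eq (label-idem x∈))
          (∈-map⁺ label (∈-filter⁺ (T? ∘ isRep A) (∈-allFin v) rep))

  λpart-↭ : λpart A ↭ map labelSize labels
  λpart-↭ = ↭-trans (sort-↭ ≤-decTotalOrder _)
    (↭-trans (↭-reflexive (trans (map-cong′ reps) (map-∘ reps))) (map⁺ labelSize reps-labels))
    where
    map-cong′ : ∀ us → map (λ u → count (compOf A u) (allFin n)) us ≡ map (labelSize ∘ label) us
    map-cong′ [] = refl
    map-cong′ (u ∷ us) = cong₂ _∷_
      (trans (count≡∑ (compOf A u) (allFin n)) (trans (∑-cong (allFin n) λ v →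
        χ-cong (λ c → subst T (sym (dec-true (label v Fin.≟ label u) (sym (to (compOf-label u v) c)))) _)
               (λ t → from (compOf-label u v) (sym (does-≟⇒≡ t))))
        (sym (count≡∑ _ (allFin n)))))
      (map-cong′ us)

Adj-⇔ : ∀ (E : List (Edge n)) u v → Adj E u v ⇔ ((u , v) ∈ E ⊎ (v , u) ∈ E)
Adj-⇔ E u v = mk⇔ fwd bwd
  where
  fwd : Adj E u v → (u , v) ∈ E ⊎ (v , u) ∈ E
  fwd t = case (Any.any⁻ _ E t)
    where
    ends : ∀ {a b c d : Fin _} → T (eqF a b ∧ eqF c d) → b ≡ a × d ≡ c
    ends {a} {b} t with s , s′ ← to (T-∧ {eqF a b}) t = sym (eqF⇒≡ s) , sym (eqF⇒≡ s′)
    case : ∀ {es} → Any (λ e → T ((eqF (proj₁ e) u ∧ eqF (proj₂ e) v) ∨ (eqF (proj₁ e) v ∧ eqF (proj₂ e) u))) es →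
      (u , v) ∈ es ⊎ (v , u) ∈ es
    case {(a , b) ∷ _} (here t) with to T-∨ t
    ... | inj₁ s with refl , refl ← ends {a} {u} {b} {v} s = inj₁ (here refl)
    ... | inj₂ s with refl , refl ← ends {a} {v} {b} {u} s = inj₂ (here refl)
    case (there t) with case t
    ... | inj₁ s = inj₁ (there s)
    ... | inj₂ s = inj₂ (there s)
  bwd : (u , v) ∈ E ⊎ (v , u) ∈ E → Adj E u v
  bwd (inj₁ e∈) = Any.any⁺ _ (Any.map (λ { refl → from T-∨ (inj₁ (from T-∧ (eqF-refl u , eqF-refl v))) }) e∈)
  bwd (inj₂ e∈) = Any.any⁺ _ (Any.map (λ { refl → from (T-∨ {eqF v u ∧ eqF u v}) (inj₂ (from T-∧ (eqF-refl v , eqF-refl u))) }) e∈)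

Adj-sym : ∀ (E : List (Edge n)) {u v} → Adj E u v → Adj E v u
Adj-sym E {u} {v} a with to (Adj-⇔ E u v) a
... | inj₁ e∈ = from (Adj-⇔ E v u) (inj₂ e∈)
... | inj₂ e∈ = from (Adj-⇔ E v u) (inj₁ e∈)

module _ {A B : Set} (f : A → B) where

  interleaving-uniqueʳ : ∀ {ls rs xs} → Interleaving ls rs xs → Unique (map f xs) → Unique (map f rs)
  interleaving-uniqueʳ [] [] = []
  interleaving-uniqueʳ (consˡ i) (_ ∷ u) = interleaving-uniqueʳ i u
  interleaving-uniqueʳ {xs = x ∷ xs} (consʳ i) (x≢ ∷ u) =
    All.map⁺ (All.++⁻ʳ _ (All-resp-↭ (toPermutation i) (All.map⁻ x≢))) ∷ interleaving-uniqueʳ i u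

  interleaving-disjoint : ∀ {ls rs xs} → Interleaving ls rs xs → Unique (map f xs) →
    ∀ {x y} → x ∈ ls → y ∈ rs → f x ≢ f y
  interleaving-disjoint (consˡ i) (x≢ ∷ _) (here refl) y∈ =
    All.lookup (All.map⁻ x≢) (∈-resp-↭ (↭-sym (toPermutation i)) (∈-++⁺ʳ _ y∈))
  interleaving-disjoint (consˡ i) (_ ∷ u) (there x∈) y∈ = interleaving-disjoint i u x∈ y∈
  interleaving-disjoint (consʳ i) (y≢ ∷ _) x∈ (here refl) =
    All.lookup (All.map⁻ y≢) (∈-resp-↭ (↭-sym (toPermutation i)) (∈-++⁺ˡ x∈)) ∘ sym
  interleaving-disjoint (consʳ i) (_ ∷ u) x∈ (there y∈) = interleaving-disjoint i u x∈ y∈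

-- Components of a rooted tree with edges removed

record RootedTree {n} (E : List (Edge n)) : Set where
  field
    root     : Fin n
    parent   : Fin n → Fin n
    depth    : Fin n → ℕ
    descends : ∀ v → v ≢ root → depth (parent v) < depth v
    child    : Edge n → Fin n
    child≢   : ∀ {e} → e ∈ E → child e ≢ root
    edge     : ∀ {e} → e ∈ E → e ≡ (child e , parent (child e)) ⊎ e ≡ (parent (child e) , child e)
    -- Together with `complete` this makes `child` a bijection from the edges to the non-root
    -- vertices, so that removing edges amounts to choosing vertices.
    distinct : Unique (map child E)
    complete : ∀ v → v ≢ root → v ∈ map child E

module Rooted {n} {E : List (Edge n)} (tree : RootedTree E) where
  open RootedTree tree
  open DecMembership (Fin._≟_ {n}) using (_∈?_)

  private
    V = Fin n

  -- Top R v x: x is the highest vertex reached from v once the edges above the vertices of R are removed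
  data Top (R : List V) : V → V → Set where
    stop  : ∀ {v} → v ∈ root ∷ R → Top R v v
    climb : ∀ {v x} → v ∉ root ∷ R → Top R (parent v) x → Top R v x

  Top-total : ∀ R v → Acc _<_ (depth v) → ∃ (Top R v)
  Top-total R v (acc rs) with v ∈? (root ∷ R)
  ... | yes v∈ = v , stop v∈
  ... | no v∉ with x , t ← Top-total R (parent v) (rs (descends v (v∉ ∘ here))) = x , climb v∉ t

  -- Everything about `top` follows from the functional relation `Top`; its computation by recursion
  -- on depth stays hidden.
  abstract
    top : List V → V → V
    top R v = proj₁ (Top-total R v (<-wellFounded (depth v)))

    top-Top : ∀ R v → Top R v (top R v)
    top-Top R v = proj₂ (Top-total R v (<-wellFounded (depth v)))

  Top-functional : ∀ {R v x y} → Top R v x → Top R v y → x ≡ y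
  Top-functional (stop _) (stop _) = refl
  Top-functional (stop v∈) (climb v∉ _) = contradiction v∈ v∉
  Top-functional (climb v∉ _) (stop v∈) = contradiction v∈ v∉
  Top-functional (climb _ t) (climb _ t′) = Top-functional t t′

  Top-∈ : ∀ {R v x} → Top R v x → x ∈ root ∷ R
  Top-∈ (stop v∈) = v∈
  Top-∈ (climb _ t) = Top-∈ t

  top-stop : ∀ R {v} → v ∈ root ∷ R → top R v ≡ v
  top-stop R {v} v∈ = Top-functional (top-Top R v) (stop v∈)

  top-climb : ∀ R {v} → v ∉ root ∷ R → top R v ≡ top R (parent v)
  top-climb R {v} v∉ = Top-functional (top-Top R v) (climb v∉ (top-Top R (parent v)))

  -- A function that fixes `root ∷ R` and is constant along all other parent links must follow each
  -- climb to its end. For a concrete `R` it is therefore enough to guess a formula for `top`.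
  top-unique : ∀ R (f : V → V) → (∀ {v} → v ∈ root ∷ R → f v ≡ v) → (∀ {v} → v ∉ root ∷ R → f v ≡ f (parent v)) →
    ∀ v → top R v ≡ f v
  top-unique R f f-stop f-climb v = go (top-Top R v)
    where
    go : ∀ {v x} → Top R v x → x ≡ f v
    go (stop v∈) = sym (f-stop v∈)
    go (climb v∉ t) = trans (go t) (sym (f-climb v∉))

  topSize : List V → V → ℕ
  topSize R x = count (λ v → does (top R v Fin.≟ x)) (allFin n)

  module _ {As Rs} (inter : Interleaving As Rs E) where

    private
      R = map child Rs

      kept : ∀ {e} → e ∈ As → e ∈ E × child e ∉ root ∷ R
      kept {e} e∈ = e∈E , λ where
          (here eq) → child≢ e∈E eq
          (there c∈) → let _ , r∈ , eq = ∈-map⁻ child c∈ in interleaving-disjoint child inter distinct e∈ r∈ eq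
        where
        e∈E : e ∈ E
        e∈E = ∈-resp-↭ (↭-sym (toPermutation inter)) (∈-++⁺ˡ e∈)

      kept-edge : ∀ {v} → v ∉ root ∷ R → Adj As v (parent v)
      kept-edge {v} v∉ with e , e∈ , refl ← ∈-map⁻ child (complete v (v∉ ∘ here))
        with ∈-++⁻ As (∈-resp-↭ (toPermutation inter) e∈)
      ... | inj₂ e∈R = contradiction (there (∈-map⁺ child e∈R)) v∉
      ... | inj₁ e∈A with edge e∈
      ...   | inj₁ eq = from (Adj-⇔ As _ _) (inj₁ (subst (_∈ As) eq e∈A))
      ...   | inj₂ eq = from (Adj-⇔ As _ _) (inj₂ (subst (_∈ As) eq e∈A))

      top-edge : ∀ {e} → e ∈ As → top R (proj₁ e) ≡ top R (proj₂ e)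
      top-edge {e} e∈ with e∈E , c∉ ← kept e∈ | edge (proj₁ (kept e∈))
      ... | inj₁ eq = subst (λ e → top R (proj₁ e) ≡ top R (proj₂ e)) (sym eq) (top-climb R c∉)
      ... | inj₂ eq = subst (λ e → top R (proj₁ e) ≡ top R (proj₂ e)) (sym eq) (sym (top-climb R c∉))

      top-adj : ∀ u v → Adj As u v → top R u ≡ top R v
      top-adj u v a with to (Adj-⇔ As u v) a
      ... | inj₁ e∈ = top-edge e∈
      ... | inj₂ e∈ = sym (top-edge e∈)

      reach-top : ∀ u {v x} → Top R v x → T (compOf As u v) ⇔ T (compOf As u x)
      reach-top u (stop _) = mk⇔ (λ c → c) (λ c → c)
      reach-top u (climb {v} v∉ t) = mk⇔
        (λ c → to (reach-top u t) (compOf-closed As u c (kept-edge v∉)))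
        (λ c → compOf-closed As u (from (reach-top u t) c) (Adj-sym As (kept-edge v∉)))

      -- Kept edges never change `top`, which gives one direction. Conversely, kept edges join every
      -- vertex to its top, so vertices with equal tops lie in one component.
      compOf-top : ∀ u v → T (compOf As u v) ⇔ (top R u ≡ top R v)
      compOf-top u v = mk⇔ (compOf-invariant As (top R) top-adj {u} {v})
        (λ eq → from (reach-top u (top-Top R v)) (subst (T ∘ compOf As u) eq (to (reach-top u (top-Top R u)) (compOf-refl As u))))

      labels-unique : Unique (root ∷ R)
      labels-unique = All.tabulate (λ { r∈ refl → root∉ r∈ }) ∷ interleaving-uniqueʳ child inter distinct
        where
        root∉ : root ∉ R
        root∉ r∈ with e , e∈ , eq ← ∈-map⁻ child r∈ =
          child≢ (∈-resp-↭ (↭-sym (toPermutation inter)) (∈-++⁺ʳ As e∈)) (sym eq)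

    λpart-top : λpart As ↭ map (topSize R) (root ∷ R)
    λpart-top = Labelled.λpart-↭ As (top R) (root ∷ R) (top-stop R) (λ v → Top-∈ (top-Top R v)) labels-unique compOf-top

-- Statistics of partitions

occ : ℕ → List ℕ → ℕ
occ k = count (k ≡ᵇ_)

-- Built from multiplicities so that order is immaterial: the sorted list `λpart` is identified with
-- the list of component sizes only up to permutation.
stat : (ℕ → ℕ → ℕ → ℕ) → ℕ → List ℕ → ℕ
stat Φ k μ = Φ (length μ) (occ 1 μ) (occ k μ)

-- The arguments are the number of parts, of parts equal to 1, and of parts equal to k.
leafStat cutStat mixedStat : ℕ → ℕ → ℕ → ℕ
leafStat 2 (suc _) m = 1
leafStat _ _ m = 0
cutStat 2 0 m = m
cutStat _ _ m = 0
mixedStat 3 (suc _) m = m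
mixedStat _ _ m = 0

stat-↭ : ∀ Φ k {μ ν} → μ ↭ ν → stat Φ k μ ≡ stat Φ k ν
stat-↭ Φ k σ = cong₂ (λ f m → f m) (cong₂ Φ (↭-length σ) (count-↭ (1 ≡ᵇ_) σ)) (count-↭ (k ≡ᵇ_) σ)

occ-∷ : ∀ k x xs → occ k (x ∷ xs) ≡ χ (x ≡ᵇ k) + occ k xs
occ-∷ k x xs = trans (count≡∑ (k ≡ᵇ_) (x ∷ xs)) (cong₂ _+_ (cong χ (≡ᵇ-comm k x)) (sym (count≡∑ (k ≡ᵇ_) xs)))
  where
  ≡ᵇ-comm : ∀ j k → (j ≡ᵇ k) ≡ (k ≡ᵇ j)
  ≡ᵇ-comm zero zero = refl
  ≡ᵇ-comm zero (suc k) = refl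
  ≡ᵇ-comm (suc j) zero = refl
  ≡ᵇ-comm (suc j) (suc k) = ≡ᵇ-comm j k

occ-1-large : ∀ {μ} → All (2 ≤_) μ → occ 1 μ ≡ 0
occ-1-large [] = refl
occ-1-large (s≤s (s≤s _) ∷ ps) = occ-1-large ps

splitSum-map : ∀ {A B : Set} (h : A → B) (φ : List B → List B → ℕ) ps xs →
  splitSum φ (map h ps) (map h xs) ≡ splitSum (λ ys zs → φ (map h ys) (map h zs)) ps xs
splitSum-map h φ ps [] = refl
splitSum-map h φ ps (x ∷ xs) = cong (φ (map h ps) (map h (x ∷ xs)) +_) (splitSum-map h φ (x ∷ ps) xs)

leafStat-1 : ∀ k s → stat leafStat k (s ∷ 1 ∷ []) ≡ 1
leafStat-1 k s with 1 ≡ᵇ s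
... | true = refl
... | false = refl

cutStat-1 : ∀ k s → stat cutStat k (s ∷ 1 ∷ []) ≡ 0
cutStat-1 k s with 1 ≡ᵇ s
... | true = refl
... | false = refl

mixedStat-1 : ∀ k s t → stat mixedStat k (s ∷ 1 ∷ t ∷ []) ≡ occ k (s ∷ 1 ∷ t ∷ [])
mixedStat-1 k s t with 1 ≡ᵇ s
... | true = refl
... | false = refl

-- Here `a` and `r` are the sizes of the two sides of a spine edge, and `s` and `t` what is left of
-- them after a leaf is detached, from the second side if `b` is true. The side that loses the leaf
-- ends with size `k` when it had `suc k` before.
indicators-shift : ∀ k s t b {a r} → s + χ (not b) ≡ a → t + χ b ≡ r → χ (s ≡ᵇ k) + χ (t ≡ᵇ k) ≡
  (if b then χ (a ≡ᵇ k) + χ (r ≡ᵇ suc k) else χ (a ≡ᵇ suc k) + χ (r ≡ᵇ k))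
indicators-shift k s t true refl refl rewrite +-identityʳ s | +-comm t 1 = refl
indicators-shift k s t false refl refl rewrite +-identityʳ t | +-comm s 1 = refl

¬T⇒false : ∀ {b} → ¬ T b → b ≡ false
¬T⇒false {false} _ = refl
¬T⇒false {true} ¬t = contradiction _ ¬t

∑-1 : ∀ {A : Set} (xs : List A) → ∑ xs (λ _ → 1) ≡ length xs
∑-1 [] = refl
∑-1 (x ∷ xs) = cong suc (∑-1 xs)

∑-δ-∉ : ∀ (xs : List (Fin n)) {x} (g : Fin n → ℕ) → x ∉ xs → ∑ xs (λ z → χ (does (x Fin.≟ z)) * g z) ≡ 0
∑-δ-∉ [] g x∉ = refl
∑-δ-∉ (z ∷ xs) {x} g x∉ rewrite dec-false (x Fin.≟ z) (x∉ ∘ here) = ∑-δ-∉ xs g (x∉ ∘ there)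

∑-δ : ∀ {xs : List (Fin n)} {x} (g : Fin n → ℕ) → Unique xs → x ∈ xs → ∑ xs (λ z → χ (does (x Fin.≟ z)) * g z) ≡ g x
∑-δ {xs = z ∷ xs} {x} g (z≢ ∷ u) (here refl) rewrite dec-true (x Fin.≟ x) refl =
  trans (cong₂ _+_ (+-identityʳ (g x)) (∑-δ-∉ xs g λ x∈ → All.lookup z≢ x∈ refl)) (+-identityʳ (g x))
∑-δ {xs = z ∷ xs} {x} g (z≢ ∷ u) (there x∈) rewrite dec-false (x Fin.≟ z) (λ { refl → All.lookup z≢ x∈ refl }) =
  ∑-δ g u x∈

∑-fibres : ∀ {xs : List (Fin n)} (ws : List (Fin n)) (f : Fin n → Fin n) (g : Fin n → ℕ) → Unique xs →
  (∀ w → f w ∈ xs) → ∑ ws (g ∘ f) ≡ ∑ xs (λ z → ∑ ws (λ w → χ (does (f w Fin.≟ z))) * g z)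
∑-fibres {xs = xs} ws f g u f∈ = begin
  ∑ ws (g ∘ f)                                                     ≡⟨ ∑-cong ws (λ w → ∑-δ g u (f∈ w)) ⟨
  ∑ ws (λ w → ∑ xs (λ z → χ (does (f w Fin.≟ z)) * g z))           ≡⟨ ∑-swap ws xs _ ⟩
  ∑ xs (λ z → ∑ ws (λ w → χ (does (f w Fin.≟ z)) * g z))           ≡⟨ ∑-cong xs (λ z → ∑-*ʳ ws _ (g z)) ⟩
  ∑ xs (λ z → ∑ ws (λ w → χ (does (f w Fin.≟ z))) * g z)           ∎
  where open ≡-Reasoning

-- Caterpillars rooted at an end of the spine

record Caterpillar {n} (E : List (Edge n)) : Set where
  field
    tree : RootedTree E
  open RootedTree tree public
  field
    spineTail : List (Fin n)
  spine : List (Fin n)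
  spine = root ∷ spineTail
  field
    spine-unique : Unique spine
    spine-depths : Linked (λ u v → depth v ≡ suc (depth u)) spine
    spine-parent : ∀ {v} → v ∈ spine → v ≢ root → parent v ∈ spine × depth v ≡ suc (depth (parent v))
    -- `foot` retracts the tree onto its spine, sending a leaf to its neighbour. Grouping vertices
    -- by `foot` turns sums over the tree into weighted sums over the spine.
    foot         : Fin n → Fin n
    foot∈        : ∀ v → foot v ∈ spine
    foot-spine   : ∀ {v} → v ∈ spine → foot v ≡ v
    leaf-parent  : ∀ {v} → v ∉ spine → parent v ≡ foot v
    -- Properness: it supplies the second vertex of a component in `topSize-spine`.
    leaf         : ∀ {v} → v ∈ spine → ∃ λ w → w ∉ spine × foot w ≡ v

module _ {n} {E : List (Edge n)} (cat : Caterpillar E) where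
  open Caterpillar cat
  open Rooted tree
  open DecMembership (Fin._≟_ {n}) using (_∈?_)

  private
    V = Fin n

  leafList : List V
  leafList = filter (λ v → ¬? (v ∈? spine)) (allFin n)

  leaf⇒∉ : ∀ {w} → w ∈ leafList → w ∉ spine
  leaf⇒∉ w∈ = proj₂ (∈-filter⁻ (λ v → ¬? (v ∈? spine)) {xs = allFin n} w∈)

  ∉⇒leaf : ∀ {w} → w ∉ spine → w ∈ leafList
  ∉⇒leaf {w} w∉ = ∈-filter⁺ (λ v → ¬? (v ∈? spine)) (∈-allFin w) w∉

  leafList-unique : Unique leafList
  leafList-unique = Unique.filter⁺ (λ v → ¬? (v ∈? spine)) (Unique.allFin⁺ n)

  spine++leafList : allFin n ↭ spine ++ leafList
  spine++leafList = ∼bag⇒↭ (unique∧set⇒bag (Unique.allFin⁺ n)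
    (Unique.++⁺ spine-unique leafList-unique λ (v∈ , w∈) → leaf⇒∉ w∈ v∈) λ {v} → mk⇔ (λ _ → split v) (λ _ → ∈-allFin v))
    where
    split : ∀ v → v ∈ spine ++ leafList
    split v with v ∈? spine
    ... | yes v∈ = ∈-++⁺ˡ v∈
    ... | no v∉ = ∈-++⁺ʳ spine (∉⇒leaf v∉)

  -- Edges are named by their lower endpoints, so this sorts them into leaf edges and spine edges.
  children : map child E ↭ leafList ++ spineTail
  children = ∼bag⇒↭ (unique∧set⇒bag distinct
    (Unique.++⁺ leafList-unique (AllPairs.tail spine-unique) (λ (w∈ , v∈) → leaf⇒∉ w∈ (there v∈))) (mk⇔ fwd bwd))
    where
    fwd : ∀ {v} → v ∈ map child E → v ∈ leafList ++ spineTail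
    fwd {v} v∈ with v ∈? spine
    ... | no v∉ = ∈-++⁺ˡ (∉⇒leaf v∉)
    ... | yes (there v∈tail) = ∈-++⁺ʳ leafList v∈tail
    ... | yes (here refl) with e , e∈ , eq ← ∈-map⁻ child v∈ = contradiction (sym eq) (child≢ e∈)
    bwd : ∀ {v} → v ∈ leafList ++ spineTail → v ∈ map child E
    bwd {v} v∈ = complete v λ { refl → [ (λ w∈ → leaf⇒∉ w∈ (here refl))
                                       , (λ t∈ → All.lookup (AllPairs.head spine-unique) t∈ refl) ]′ (∈-++⁻ leafList v∈) }

  leavesOn : V → ℕ
  leavesOn z = ∑ leafList (λ w → χ (does (foot w Fin.≟ z)))

  sequence : List ℕ
  sequence = map (suc ∘ leavesOn) spine

  fibre-size : ∀ {z} → z ∈ spine → ∑ (allFin n) (λ v → χ (does (foot v Fin.≟ z))) ≡ suc (leavesOn z)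
  fibre-size {z} z∈ = begin
    ∑ (allFin n) (λ v → χ (does (foot v Fin.≟ z)))               ≡⟨ ∑-↭ _ spine++leafList ⟩
    ∑ (spine ++ leafList) (λ v → χ (does (foot v Fin.≟ z)))      ≡⟨ ∑-++ spine leafList _ ⟩
    ∑ spine (λ v → χ (does (foot v Fin.≟ z))) + leavesOn z       ≡⟨ cong (_+ leavesOn z) (∑-cong-∈ spine λ {v} v∈ →
                                                                      trans (cong (λ u → χ (does (u Fin.≟ z))) (foot-spine v∈))
                                                                      (trans (χ-≟-sym v z) (sym (*-identityʳ _)))) ⟩
    ∑ spine (λ v → χ (does (z Fin.≟ v)) * 1) + leavesOn z        ≡⟨ cong (_+ leavesOn z) (∑-δ (λ _ → 1) spine-unique z∈) ⟩
    suc (leavesOn z)                                             ∎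
    where
    open ≡-Reasoning
    χ-≟-sym : ∀ (u v : V) → χ (does (u Fin.≟ v)) ≡ χ (does (v Fin.≟ u))
    χ-≟-sym u v with u Fin.≟ v
    ... | yes refl = sym (cong χ (dec-true (u Fin.≟ u) refl))
    ... | no u≢v = sym (cong χ (dec-false (v Fin.≟ u) (u≢v ∘ sym)))

  ∑-foot : ∀ (g : V → ℕ) → ∑ (allFin n) (g ∘ foot) ≡ ∑ spine (λ z → suc (leavesOn z) * g z)
  ∑-foot g = trans (∑-fibres (allFin n) foot g spine-unique foot∈) (∑-cong-∈ spine λ {z} z∈ → cong (_* g z) (fibre-size z∈))

  ∑-leaf-foot : ∀ (g : V → ℕ) → ∑ leafList (g ∘ foot) ≡ ∑ spine (λ z → leavesOn z * g z)
  ∑-leaf-foot g = ∑-fibres leafList foot g spine-unique foot∈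

  sum-sequence : sum sequence ≡ n
  sum-sequence = begin
    sum (map (suc ∘ leavesOn) spine)       ≡⟨ ∑-cong spine (λ z → *-identityʳ (suc (leavesOn z))) ⟨
    ∑ spine (λ z → suc (leavesOn z) * 1)   ≡⟨ ∑-foot (λ _ → 1) ⟨
    ∑ (allFin n) (λ _ → 1)                 ≡⟨ ∑-1 (allFin n) ⟩
    length (allFin n)                      ≡⟨ length-tabulate (λ i → i) ⟩
    n                                      ∎
    where open ≡-Reasoning

  leaves-map : ∀ zs → leaves (map (suc ∘ leavesOn) zs) ≡ ∑ zs leavesOn
  leaves-map [] = refl
  leaves-map (z ∷ zs) = cong (leavesOn z +_) (leaves-map zs)

  leaves-sequence : leaves sequence ≡ ∑ leafList (λ _ → 1)
  leaves-sequence = begin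
    leaves sequence                    ≡⟨ leaves-map spine ⟩
    ∑ spine leavesOn                   ≡⟨ ∑-cong spine (λ z → *-identityʳ (leavesOn z)) ⟨
    ∑ spine (λ z → leavesOn z * 1)     ≡⟨ ∑-leaf-foot (λ _ → 1) ⟨
    ∑ leafList (λ _ → 1)               ∎
    where open ≡-Reasoning

  ∑-subsets-stat : ∀ Φ k → ∑ (subsets E) (stat Φ k ∘ λpart) ≡
    ∑removed E (λ Rs → stat Φ k (map (topSize (map child Rs)) (root ∷ map child Rs)))
  ∑-subsets-stat Φ k = ∑-subsets E _ _ (λ inter → stat-↭ Φ k (λpart-top inter))

  -- Removing leaf edges

  parent∈spine : ∀ {v} → v ≢ root → parent v ∈ spine
  parent∈spine {v} v≢ with v ∈? spine
  ... | yes v∈ = proj₁ (spine-parent v∈ v≢)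
  ... | no v∉ = subst (_∈ spine) (sym (leaf-parent v∉)) (foot∈ v)

  module _ {w} (w∉ : w ∉ spine) where

    -- Parents lie on the spine, so a leaf is never a parent, and detaching it changes the top of no
    -- other vertex.
    top-∷-leaf : ∀ R → w ∉ R → ∀ v → v ≢ w → top (w ∷ R) v ≡ top R v
    top-∷-leaf R w∉R v v≢w = trans (top-unique (w ∷ R) f f-stop f-climb v) (f-≢ v≢w)
      where
      f : V → V
      f v = if does (v Fin.≟ w) then w else top R v
      f-w : f w ≡ w
      f-w rewrite dec-true (w Fin.≟ w) refl = refl
      f-≢ : ∀ {v} → v ≢ w → f v ≡ top R v
      f-≢ {v} v≢w rewrite dec-false (v Fin.≟ w) v≢w = refl
      f-stop : ∀ {v} → v ∈ root ∷ w ∷ R → f v ≡ v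
      f-stop (here refl) = trans (f-≢ (λ { refl → w∉ (here refl) })) (top-stop R (here refl))
      f-stop (there (here refl)) = f-w
      f-stop (there (there v∈)) = trans (f-≢ (λ { refl → w∉R v∈ })) (top-stop R (there v∈))
      f-climb : ∀ {v} → v ∉ root ∷ w ∷ R → f v ≡ f (parent v)
      f-climb {v} v∉ = trans (f-≢ (λ eq → v∉ (there (here eq))))
        (trans (top-climb R (λ { (here eq) → v∉ (here eq) ; (there v∈) → v∉ (there (there v∈)) }))
        (sym (f-≢ λ eq → w∉ (subst (_∈ spine) eq (parent∈spine (v∉ ∘ here))))))

    top-∷-leaf-self : ∀ R → top (w ∷ R) w ≡ w
    top-∷-leaf-self R = top-stop (w ∷ R) (there (here refl))

    -- Only the component that contained `w` loses a vertex. The loss is an added indicator on the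
    -- left, which `∑-δ` spreads over all vertices so that the identity can be checked pointwise.
    topSize-∷-leaf : ∀ R → w ∉ R → ∀ x → x ≢ w → topSize (w ∷ R) x + χ (does (top R w Fin.≟ x)) ≡ topSize R x
    topSize-∷-leaf R w∉R x x≢w = begin
      topSize (w ∷ R) x + χ (does (top R w Fin.≟ x))
        ≡⟨ cong₂ _+_ (count≡∑ _ (allFin n)) (sym (∑-δ (λ v → χ (does (top R v Fin.≟ x))) (Unique.allFin⁺ n) (∈-allFin w))) ⟩
      ∑ (allFin n) (λ v → χ (does (top (w ∷ R) v Fin.≟ x))) + ∑ (allFin n) (λ v → χ (does (w Fin.≟ v)) * χ (does (top R v Fin.≟ x)))
        ≡⟨ ∑-+ (allFin n) _ _ ⟨
      ∑ (allFin n) (λ v → χ (does (top (w ∷ R) v Fin.≟ x)) + χ (does (w Fin.≟ v)) * χ (does (top R v Fin.≟ x)))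
        ≡⟨ ∑-cong (allFin n) pointwise ⟩
      ∑ (allFin n) (λ v → χ (does (top R v Fin.≟ x)))
        ≡⟨ count≡∑ _ (allFin n) ⟨
      topSize R x ∎
      where
      open ≡-Reasoning
      pointwise : ∀ v → χ (does (top (w ∷ R) v Fin.≟ x)) + χ (does (w Fin.≟ v)) * χ (does (top R v Fin.≟ x)) ≡ χ (does (top R v Fin.≟ x))
      pointwise v with w Fin.≟ v
      ... | yes refl rewrite top-∷-leaf-self R | dec-false (w Fin.≟ x) (x≢w ∘ sym) = +-identityʳ _
      ... | no w≢v rewrite top-∷-leaf R w∉R v (w≢v ∘ sym) = +-identityʳ _

    topSize-∷-leaf-self : ∀ R → w ∉ R → topSize (w ∷ R) w ≡ 1
    topSize-∷-leaf-self R w∉R = begin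
      topSize (w ∷ R) w                                          ≡⟨ count≡∑ _ (allFin n) ⟩
      ∑ (allFin n) (λ v → χ (does (top (w ∷ R) v Fin.≟ w)))      ≡⟨ ∑-cong (allFin n) pointwise ⟩
      ∑ (allFin n) (λ v → χ (does (w Fin.≟ v)) * 1)              ≡⟨ ∑-δ (λ _ → 1) (Unique.allFin⁺ n) (∈-allFin w) ⟩
      1                                                          ∎
      where
      open ≡-Reasoning
      pointwise : ∀ v → χ (does (top (w ∷ R) v Fin.≟ w)) ≡ χ (does (w Fin.≟ v)) * 1
      pointwise v with w Fin.≟ v
      ... | yes refl = cong χ (dec-true (_ Fin.≟ w) (top-∷-leaf-self R))
      ... | no w≢v = cong χ (dec-false (_ Fin.≟ w) λ eq → absurd (trans (sym (top-∷-leaf R w∉R v (w≢v ∘ sym))) eq))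
        where
        absurd : top R v ≢ w
        absurd eq with subst (_∈ root ∷ R) eq (Top-∈ (top-Top R v))
        ... | here refl = w∉ (here refl)
        ... | there w∈R = w∉R w∈R

  -- The component contains `x` and a leaf at `x`, which stays attached because only edges above
  -- spine vertices are removed. A part 1 thus always betrays a removed leaf edge.
  topSize-spine : ∀ R {x} → All (_∈ spine) R → x ∈ root ∷ R → 2 ≤ topSize R x
  topSize-spine R {x} R⊆ x∈ with x∈spine ← All.lookup (here refl ∷ R⊆) x∈
    with w , w∉ , foot≡ ← leaf x∈spine = begin
    2                                                            ≡⟨ cong₂ _+_ (∑-δ (λ _ → 1) (Unique.allFin⁺ n) (∈-allFin x))
                                                                              (∑-δ (λ _ → 1) (Unique.allFin⁺ n) (∈-allFin w)) ⟨
    ∑ (allFin n) (λ v → χ (does (x Fin.≟ v)) * 1) + ∑ (allFin n) (λ v → χ (does (w Fin.≟ v)) * 1)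
                                                                 ≡⟨ ∑-+ (allFin n) _ _ ⟨
    ∑ (allFin n) (λ v → χ (does (x Fin.≟ v)) * 1 + χ (does (w Fin.≟ v)) * 1)
                                                                 ≤⟨ ∑-mono-≤ (allFin n) pointwise ⟩
    ∑ (allFin n) (λ v → χ (does (top R v Fin.≟ x)))              ≡⟨ count≡∑ _ (allFin n) ⟨
    topSize R x                                                  ∎
    where
    open ≤-Reasoning
    w∉R : w ∉ root ∷ R
    w∉R w∈ = w∉ (All.lookup (here refl ∷ R⊆) w∈)
    top-w : top R w ≡ x
    top-w = trans (top-climb R w∉R) (trans (cong (top R) (trans (leaf-parent w∉) foot≡)) (top-stop R x∈))
    pointwise : ∀ v → χ (does (x Fin.≟ v)) * 1 + χ (does (w Fin.≟ v)) * 1 ≤ χ (does (top R v Fin.≟ x))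
    pointwise v with x Fin.≟ v | w Fin.≟ v
    ... | yes refl | yes refl = contradiction x∈spine w∉
    ... | yes refl | no _ rewrite dec-true (top R x Fin.≟ x) (top-stop R x∈) = ≤-refl
    ... | no _ | yes refl rewrite dec-true (top R w Fin.≟ x) top-w = ≤-refl
    ... | no _ | no _ = z≤n

  ∑-children : ∀ (f : V → ℕ) → ∑ E (f ∘ child) ≡ ∑ leafList f + ∑ spineTail f
  ∑-children f = trans (sym (∑-map child E f)) (trans (∑-↭ f children) (∑-++ leafList spineTail f))

  top-swap : ∀ x y v → top (x ∷ y ∷ []) v ≡ top (y ∷ x ∷ []) v
  top-swap x y = top-unique (x ∷ y ∷ []) (top (y ∷ x ∷ [])) (top-stop (y ∷ x ∷ []) ∘ swap x y)
    (λ v∉ → top-climb (y ∷ x ∷ []) (v∉ ∘ swap y x))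
    where
    swap : ∀ x y {v} → v ∈ root ∷ x ∷ y ∷ [] → v ∈ root ∷ y ∷ x ∷ []
    swap x y (here eq) = here eq
    swap x y (there (here eq)) = there (there (here eq))
    swap x y (there (there (here eq))) = there (here eq)

  sizes : List V → List ℕ
  sizes R = map (topSize R) (root ∷ R)

  sizes-swap : ∀ x y → sizes (x ∷ y ∷ []) ↭ sizes (y ∷ x ∷ [])
  sizes-swap x y = ↭-trans (↭-reflexive (map-cong topSize≡ (root ∷ x ∷ y ∷ []))) (↭.prep _ (↭.swap _ _ ↭-refl))
    where
    topSize≡ : ∀ z → topSize (x ∷ y ∷ []) z ≡ topSize (y ∷ x ∷ []) z
    topSize≡ z = trans (count≡∑ _ (allFin n))
      (trans (∑-cong (allFin n) λ v → cong (λ u → χ (does (u Fin.≟ z))) (top-swap x y v)) (sym (count≡∑ _ (allFin n))))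

  top-[] : ∀ v → top [] v ≡ root
  top-[] v with here eq ← Top-∈ (top-Top [] v) = eq

  topSize-[] : topSize [] root ≡ n
  topSize-[] = begin
    topSize [] root                                         ≡⟨ count≡∑ _ (allFin n) ⟩
    ∑ (allFin n) (λ v → χ (does (top [] v Fin.≟ root)))     ≡⟨ ∑-cong (allFin n) (λ v → cong χ (dec-true (top [] v Fin.≟ root) (top-[] v))) ⟩
    ∑ (allFin n) (λ _ → 1)                                  ≡⟨ ∑-1 (allFin n) ⟩
    length (allFin n)                                       ≡⟨ length-tabulate (λ i → i) ⟩
    n                                                       ∎
    where open ≡-Reasoning

  sizes-spine : ∀ {R} → All (_∈ spine) R → occ 1 (sizes R) ≡ 0
  sizes-spine R⊆ = occ-1-large (All.map⁺ (All.tabulate (topSize-spine _ R⊆)))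

  sizes-leaf : ∀ {w} → w ∉ spine → sizes (w ∷ []) ≡ topSize (w ∷ []) root ∷ 1 ∷ []
  sizes-leaf {w} w∉ = cong (λ m → topSize (w ∷ []) root ∷ m ∷ []) (topSize-∷-leaf-self w∉ [] λ ())

  module _ {w w′} (w∉ : w ∉ spine) (w′∉ : w′ ∉ spine) (w≢w′ : w ≢ w′) where

    private
      w∉[w′] : w ∉ w′ ∷ []
      w∉[w′] (here eq) = w≢w′ eq
      root≢ : ∀ {v} → v ∉ spine → root ≢ v
      root≢ v∉ refl = v∉ (here refl)
      top-w : top (w′ ∷ []) w ≡ root
      top-w = trans (top-∷-leaf w′∉ [] (λ ()) w w≢w′) (top-[] w)

    sizes-two-leaves : sizes (w ∷ w′ ∷ []) ≡ topSize (w ∷ w′ ∷ []) root ∷ 1 ∷ 1 ∷ []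
    sizes-two-leaves = cong₂ (λ l m → topSize (w ∷ w′ ∷ []) root ∷ l ∷ m ∷ []) (topSize-∷-leaf-self w∉ (w′ ∷ []) w∉[w′]) (begin
      topSize (w ∷ w′ ∷ []) w′                                                 ≡⟨ +-identityʳ _ ⟨
      topSize (w ∷ w′ ∷ []) w′ + 0                                             ≡⟨ cong (λ b → topSize (w ∷ w′ ∷ []) w′ + χ b)
                                                                                   (dec-false (top (w′ ∷ []) w Fin.≟ w′) (λ eq → root≢ w′∉ (trans (sym top-w) eq))) ⟨
      topSize (w ∷ w′ ∷ []) w′ + χ (does (top (w′ ∷ []) w Fin.≟ w′))          ≡⟨ topSize-∷-leaf w∉ (w′ ∷ []) w∉[w′] w′ (w≢w′ ∘ sym) ⟩
      topSize (w′ ∷ []) w′                                                     ≡⟨ topSize-∷-leaf-self w′∉ [] (λ ()) ⟩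
      1                                                                        ∎)
      where open ≡-Reasoning

    topSize-two-leaves : topSize (w ∷ w′ ∷ []) root + 2 ≡ n
    topSize-two-leaves = begin
      topSize (w ∷ w′ ∷ []) root + 2
        ≡⟨ +-assoc (topSize (w ∷ w′ ∷ []) root) 1 1 ⟨
      topSize (w ∷ w′ ∷ []) root + 1 + 1
        ≡⟨ cong₂ (λ b c → topSize (w ∷ w′ ∷ []) root + χ b + χ c)
             (dec-true (top (w′ ∷ []) w Fin.≟ root) top-w) (dec-true (top [] w′ Fin.≟ root) (top-[] w′)) ⟨
      topSize (w ∷ w′ ∷ []) root + χ (does (top (w′ ∷ []) w Fin.≟ root)) + χ (does (top [] w′ Fin.≟ root))
        ≡⟨ cong (_+ χ (does (top [] w′ Fin.≟ root))) (topSize-∷-leaf w∉ (w′ ∷ []) w∉[w′] root (root≢ w∉)) ⟩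
      topSize (w′ ∷ []) root + χ (does (top [] w′ Fin.≟ root))
        ≡⟨ topSize-∷-leaf w′∉ [] (λ ()) root (root≢ w′∉) ⟩
      topSize [] root
        ≡⟨ topSize-[] ⟩
      n ∎
      where open ≡-Reasoning

  -- Removing a spine edge

  seq : List V → List ℕ
  seq = map (suc ∘ leavesOn)

  -- Depth alone decides on which side of the edge above `y` a spine vertex lies. It suffices to
  -- know the spine up to permutation, which suits the reversed left piece `ps` of a cut.
  record Cut (ps : List V) (y : V) (ys : List V) : Set where
    field
      spine-↭ : spine ↭ ps ++ y ∷ ys
      root∈   : root ∈ ps
      above   : All (λ z → depth z < depth y) ps
      below   : All (λ z → depth y < depth z) ys

  module _ {ps y ys} (cut : Cut ps y ys) where
    open Cut cut

    private
      beyond : V → Bool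
      beyond z = depth y ≤ᵇ depth z

      beyond-ps : ∀ {z} → z ∈ ps → beyond z ≡ false
      beyond-ps z∈ = ¬T⇒false (λ t → <⇒≱ (All.lookup above z∈) (≤ᵇ⇒≤ (depth y) _ t))

      beyond-ys : ∀ {z} → z ∈ y ∷ ys → beyond z ≡ true
      beyond-ys (here refl) = to T-≡ (≤⇒≤ᵇ {depth y} ≤-refl)
      beyond-ys (there z∈) = to T-≡ (≤⇒≤ᵇ (<⇒≤ (All.lookup below z∈)))

      y∈ : y ∈ spine
      y∈ = ∈-resp-↭ (↭-sym spine-↭) (∈-++⁺ʳ ps (here refl))

      y≢root : y ≢ root
      y≢root refl = <-irrefl refl (All.lookup above root∈)

      -- The depths along the spine are consecutive, so only y separates the two sides.
      beyond-parent : ∀ {v} → v ∈ spine → v ≢ root → v ≢ y → beyond v ≡ beyond (parent v)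
      beyond-parent {v} v∈ v≢root v≢y with _ , depth≡ ← spine-parent v∈ v≢root
        with ∈-++⁻ ps (∈-resp-↭ spine-↭ v∈)
      ... | inj₁ v∈ps = trans (beyond-ps v∈ps) (sym (¬T⇒false λ t →
            <⇒≱ (All.lookup above v∈ps) (≤-trans (≤ᵇ⇒≤ (depth y) _ t) (subst (depth (parent v) ≤_) (sym depth≡) (n≤1+n _)))))
      ... | inj₂ (here v≡y) = contradiction v≡y v≢y
      ... | inj₂ (there v∈ys) = trans (beyond-ys (there v∈ys))
            (sym (to T-≡ (≤⇒≤ᵇ (≤-pred (subst (depth y <_) depth≡ (All.lookup below v∈ys))))))

      -- The guess for `top-unique`: removing the edge above `y` leaves components with tops `root`
      -- and `y`, and a leaf goes with its foot.
      side : V → V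
      side v = if beyond (foot v) then y else root

      top-side : ∀ v → top (y ∷ []) v ≡ side v
      top-side = top-unique (y ∷ []) side stop′ climb′
        where
        stop′ : ∀ {v} → v ∈ root ∷ y ∷ [] → side v ≡ v
        stop′ (here refl) rewrite foot-spine (here {xs = spineTail} (refl {x = root})) | beyond-ps root∈ = refl
        stop′ (there (here refl)) rewrite foot-spine y∈ | beyond-ys (here refl) = refl
        climb′ : ∀ {v} → v ∉ root ∷ y ∷ [] → side v ≡ side (parent v)
        climb′ {v} v∉ with v ∈? spine
        ... | yes v∈ rewrite foot-spine v∈ | foot-spine (proj₁ (spine-parent v∈ (v∉ ∘ here)))
                           | beyond-parent v∈ (v∉ ∘ here) (λ eq → v∉ (there (here eq))) = refl
        ... | no v∉spine rewrite leaf-parent v∉spine | foot-spine (foot∈ v) = refl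

      ∑-sides : ∀ (c : V → ℕ) (h : Bool → ℕ) →
        ∑ spine (λ z → c z * h (beyond z)) ≡ ∑ ps c * h false + ∑ (y ∷ ys) c * h true
      ∑-sides c h = begin
        ∑ spine (λ z → c z * h (beyond z))
          ≡⟨ ∑-↭ _ spine-↭ ⟩
        ∑ (ps ++ y ∷ ys) (λ z → c z * h (beyond z))
          ≡⟨ ∑-++ ps (y ∷ ys) _ ⟩
        ∑ ps (λ z → c z * h (beyond z)) + ∑ (y ∷ ys) (λ z → c z * h (beyond z))
          ≡⟨ cong₂ _+_ (∑-cong-∈ ps λ {z} z∈ → cong (λ b → c z * h b) (beyond-ps z∈))
                       (∑-cong-∈ (y ∷ ys) λ {z} z∈ → cong (λ b → c z * h b) (beyond-ys z∈)) ⟩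
        ∑ ps (λ z → c z * h false) + ∑ (y ∷ ys) (λ z → c z * h true)
          ≡⟨ cong₂ _+_ (∑-*ʳ ps c (h false)) (∑-*ʳ (y ∷ ys) c (h true)) ⟩
        ∑ ps c * h false + ∑ (y ∷ ys) c * h true ∎
        where open ≡-Reasoning

      indicator-root : ∀ b → χ (does ((if b then y else root) Fin.≟ root)) ≡ χ (not b)
      indicator-root true = cong χ (dec-false (y Fin.≟ root) y≢root)
      indicator-root false = cong χ (dec-true (root Fin.≟ root) refl)

      indicator-y : ∀ b → χ (does ((if b then y else root) Fin.≟ y)) ≡ χ b
      indicator-y true = cong χ (dec-true (y Fin.≟ y) refl)
      indicator-y false = cong χ (dec-false (root Fin.≟ y) (y≢root ∘ sym))

      topSize-side : ∀ x (h : Bool → ℕ) → (∀ b → χ (does ((if b then y else root) Fin.≟ x)) ≡ h b) →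
        topSize (y ∷ []) x ≡ sum (seq ps) * h false + sum (seq (y ∷ ys)) * h true
      topSize-side x h indicator = begin
        topSize (y ∷ []) x                                        ≡⟨ count≡∑ _ (allFin n) ⟩
        ∑ (allFin n) (λ v → χ (does (top (y ∷ []) v Fin.≟ x)))    ≡⟨ ∑-cong (allFin n) (λ v → trans (cong (λ u → χ (does (u Fin.≟ x))) (top-side v)) (indicator (beyond (foot v)))) ⟩
        ∑ (allFin n) (λ v → h (beyond (foot v)))                  ≡⟨ ∑-foot (h ∘ beyond) ⟩
        ∑ spine (λ z → suc (leavesOn z) * h (beyond z))           ≡⟨ ∑-sides (suc ∘ leavesOn) h ⟩
        sum (seq ps) * h false + sum (seq (y ∷ ys)) * h true     ∎
        where open ≡-Reasoning

      topSize-root : topSize (y ∷ []) root ≡ sum (seq ps)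
      topSize-root = trans (topSize-side root (χ ∘ not) indicator-root)
        (trans (cong₂ _+_ (*-identityʳ (sum (seq ps))) (*-zeroʳ (sum (seq (y ∷ ys))))) (+-identityʳ _))

      topSize-y : topSize (y ∷ []) y ≡ sum (seq (y ∷ ys))
      topSize-y = trans (topSize-side y χ indicator-y)
        (cong₂ _+_ (*-zeroʳ (sum (seq ps))) (*-identityʳ (sum (seq (y ∷ ys)))))

    cutStat-spine : ∀ k → stat cutStat k (sizes (y ∷ [])) ≡ sizeHits k (seq ps) (seq (y ∷ ys))
    cutStat-spine k rewrite sizes-spine (y∈ ∷ []) = begin
      occ k (topSize (y ∷ []) root ∷ topSize (y ∷ []) y ∷ [])      ≡⟨ cong₂ (λ a b → occ k (a ∷ b ∷ [])) topSize-root topSize-y ⟩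
      occ k (sum (seq ps) ∷ sum (seq (y ∷ ys)) ∷ [])              ≡⟨ occ-∷ k (sum (seq ps)) _ ⟩
      χ (sum (seq ps) ≡ᵇ k) + occ k (sum (seq (y ∷ ys)) ∷ [])     ≡⟨ cong (χ (sum (seq ps) ≡ᵇ k) +_) (trans (occ-∷ k (sum (seq (y ∷ ys))) []) (+-identityʳ _)) ⟩
      sizeHits k (seq ps) (seq (y ∷ ys))                          ∎
      where open ≡-Reasoning

    -- The spine edge is fixed and the leaf varies. A part of size `k` is either a side of size
    -- `suc k` that has lost this leaf, a same-side pair, or a side of size `k` facing the leaf, an
    -- other-side pair. The leaf's own part is not counted, as `k` exceeds 1.
    mixedStat-spine : ∀ k → 2 ≤ k → ∑ leafList (λ w → stat mixedStat k (sizes (w ∷ y ∷ []))) ≡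
      sameSide (suc k) (seq ps) (seq (y ∷ ys)) + otherSide k (seq ps) (seq (y ∷ ys))
    mixedStat-spine k 2≤k = begin
      ∑ leafList (λ w → stat mixedStat k (sizes (w ∷ y ∷ [])))
        ≡⟨ ∑-cong-∈ leafList (λ w∈ → value (leaf⇒∉ w∈)) ⟩
      ∑ leafList (λ w → h (beyond (foot w)))
        ≡⟨ ∑-leaf-foot (h ∘ beyond) ⟩
      ∑ spine (λ z → leavesOn z * h (beyond z))
        ≡⟨ ∑-sides leavesOn h ⟩
      ∑ ps leavesOn * h false + ∑ (y ∷ ys) leavesOn * h true
        ≡⟨ cong₂ (λ l m → l * h false + m * h true) (leaves-map ps) (leaves-map (y ∷ ys)) ⟨
      leaves (seq ps) * h false + leaves (seq (y ∷ ys)) * h true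
        ≡⟨ expand (leaves (seq ps)) (leaves (seq (y ∷ ys))) (χ (a ≡ᵇ suc k)) (χ (r ≡ᵇ k)) (χ (a ≡ᵇ k)) (χ (r ≡ᵇ suc k)) ⟩
      sameSide (suc k) (seq ps) (seq (y ∷ ys)) + otherSide k (seq ps) (seq (y ∷ ys)) ∎
      where
      open ≡-Reasoning
      a r : ℕ
      a = sum (seq ps)
      r = sum (seq (y ∷ ys))
      h : Bool → ℕ
      h b = if b then χ (a ≡ᵇ k) + χ (r ≡ᵇ suc k) else χ (a ≡ᵇ suc k) + χ (r ≡ᵇ k)
      expand : ∀ l m p q s t → l * (p + q) + m * (s + t) ≡ (l * p + m * t) + (m * s + l * q)
      expand = solve-∀
      occ-value : ∀ s t b → s + χ (not b) ≡ a → t + χ b ≡ r → occ k (s ∷ 1 ∷ t ∷ []) ≡ h b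
      occ-value s t b s≡ t≡ = trans (trans (occ-∷ k s _) (cong (χ (s ≡ᵇ k) +_) (trans (occ-∷ k 1 _)
          (cong₂ _+_ (cong χ (≢⇒≡ᵇ-false (<⇒≢ 2≤k))) (trans (occ-∷ k t []) (+-identityʳ _)))))) (indicators-shift k s t b s≡ t≡)
      value : ∀ {w} → w ∉ spine → stat mixedStat k (sizes (w ∷ y ∷ [])) ≡ h (beyond (foot w))
      value {w} w∉ = begin
        stat mixedStat k (sizes (w ∷ y ∷ []))
          ≡⟨ cong (λ m → stat mixedStat k (s ∷ m ∷ t ∷ [])) (topSize-∷-leaf-self w∉ (y ∷ []) w∉[y]) ⟩
        stat mixedStat k (s ∷ 1 ∷ t ∷ [])
          ≡⟨ mixedStat-1 k s t ⟩
        occ k (s ∷ 1 ∷ t ∷ [])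
          ≡⟨ occ-value s t (beyond (foot w))
               (trans (cong (s +_) (sym (trans (cong (λ u → χ (does (u Fin.≟ root))) (top-side w)) (indicator-root (beyond (foot w))))))
                 (trans (topSize-∷-leaf w∉ (y ∷ []) w∉[y] root (λ { refl → w∉ (here refl) })) topSize-root))
               (trans (cong (t +_) (sym (trans (cong (λ u → χ (does (u Fin.≟ y))) (top-side w)) (indicator-y (beyond (foot w))))))
                 (trans (topSize-∷-leaf w∉ (y ∷ []) w∉[y] y (λ { refl → w∉ y∈ })) topSize-y)) ⟩
        h (beyond (foot w)) ∎
        where
        s t : ℕ
        s = topSize (w ∷ y ∷ []) root
        t = topSize (w ∷ y ∷ []) y
        w∉[y] : w ∉ y ∷ []
        w∉[y] (here refl) = w∉ y∈

  -- The edge above `y` corresponds to the cut just before `y`. The proof walks down the spine in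
  -- step with `splitSum` and maintains the data of a `Cut`.
  ∑-spineTail : ∀ (ψ : V → ℕ) (φ : List ℕ → List ℕ → ℕ) →
    (∀ {ps y ys} → Cut ps y ys → ψ y ≡ φ (seq ps) (seq (y ∷ ys))) → ∑ spineTail ψ ≡ cuts φ sequence
  ∑-spineTail ψ φ eq = trans (go [] root spineTail ↭-refl (here refl) [] spine-depths) (sym (splitSum-map (suc ∘ leavesOn) φ (root ∷ []) spineTail))
    where
    deeper : ∀ {u v vs} → depth u < depth v → Linked (λ u v → depth v ≡ suc (depth u)) (v ∷ vs) →
      All (λ z → depth u < depth z) (v ∷ vs)
    deeper u<v [-] = u<v ∷ []
    deeper u<v (v≡ ∷ linked) = u<v ∷ deeper (<-trans u<v (≤-reflexive (sym v≡))) linked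
    below : ∀ {v vs} → Linked (λ u v → depth v ≡ suc (depth u)) (v ∷ vs) → All (λ z → depth v < depth z) vs
    below [-] = []
    below (v≡ ∷ linked) = deeper (≤-reflexive (sym v≡)) linked
    go : ∀ ps u ys → spine ↭ (u ∷ ps) ++ ys → root ∈ u ∷ ps → All (λ z → depth z < depth u) ps →
      Linked (λ u v → depth v ≡ suc (depth u)) (u ∷ ys) →
      ∑ ys ψ ≡ splitSum (λ xs zs → φ (seq xs) (seq zs)) (u ∷ ps) ys
    go ps u [] _ _ _ _ = refl
    go ps u (y ∷ ys) σ r∈ above (y≡ ∷ linked) = cong₂ _+_
      (eq (record { spine-↭ = σ ; root∈ = r∈ ; above = above′ ; below = below linked }))
      (go (u ∷ ps) y ys (↭-trans σ (shift y (u ∷ ps) ys)) (there r∈) above′ linked)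
      where
      u<y : depth u < depth y
      u<y = ≤-reflexive (sym y≡)
      above′ : All (λ z → depth z < depth y) (u ∷ ps)
      above′ = u<y ∷ All.map (λ z<u → <-trans z<u u<y) above

  -- The three statistics summed over all edge sets

  private
    tail∈ : ∀ {y} → y ∈ spineTail → y ∈ spine
    tail∈ = there

  ∑-leafStat : ∑ (subsets E) (stat leafStat 0 ∘ λpart) ≡ leaves sequence
  ∑-leafStat = begin
    ∑ (subsets E) (stat leafStat 0 ∘ λpart)                             ≡⟨ ∑-subsets-stat leafStat 0 ⟩
    ∑removed E (λ Rs → stat leafStat 0 (sizes (map child Rs)))          ≡⟨ ∑removed-one E refl (λ _ _ _ → refl) ⟩
    ∑ E (λ e → stat leafStat 0 (sizes (child e ∷ [])))                  ≡⟨ ∑-children (λ v → stat leafStat 0 (sizes (v ∷ []))) ⟩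
    ∑ leafList (λ w → stat leafStat 0 (sizes (w ∷ [])))
      + ∑ spineTail (λ y → stat leafStat 0 (sizes (y ∷ [])))            ≡⟨ cong₂ _+_ (∑-cong-∈ leafList (on-leaf ∘ leaf⇒∉))
                                                                                     (trans (∑-cong-∈ spineTail on-spine) (∑-zero spineTail)) ⟩
    ∑ leafList (λ _ → 1) + 0                                            ≡⟨ +-identityʳ _ ⟩
    ∑ leafList (λ _ → 1)                                                ≡⟨ leaves-sequence ⟨
    leaves sequence                                                     ∎
    where
    open ≡-Reasoning
    on-leaf : ∀ {w} → w ∉ spine → stat leafStat 0 (sizes (w ∷ [])) ≡ 1
    on-leaf {w} w∉ = trans (cong (stat leafStat 0) (sizes-leaf w∉)) (leafStat-1 0 (topSize (w ∷ []) root))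
    on-spine : ∀ {y} → y ∈ spineTail → stat leafStat 0 (sizes (y ∷ [])) ≡ 0
    on-spine y∈ rewrite sizes-spine (tail∈ y∈ ∷ []) = refl

  ∑-cutStat : ∀ k → ∑ (subsets E) (stat cutStat k ∘ λpart) ≡ cuts (sizeHits k) sequence
  ∑-cutStat k = begin
    ∑ (subsets E) (stat cutStat k ∘ λpart)                              ≡⟨ ∑-subsets-stat cutStat k ⟩
    ∑removed E (λ Rs → stat cutStat k (sizes (map child Rs)))           ≡⟨ ∑removed-one E refl (λ _ _ _ → refl) ⟩
    ∑ E (λ e → stat cutStat k (sizes (child e ∷ [])))                   ≡⟨ ∑-children (λ v → stat cutStat k (sizes (v ∷ []))) ⟩
    ∑ leafList (λ w → stat cutStat k (sizes (w ∷ [])))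
      + ∑ spineTail (λ y → stat cutStat k (sizes (y ∷ [])))             ≡⟨ cong₂ _+_ (trans (∑-cong-∈ leafList (on-leaf ∘ leaf⇒∉)) (∑-zero leafList))
                                                                                     (∑-spineTail _ (sizeHits k) (λ cut → cutStat-spine cut k)) ⟩
    cuts (sizeHits k) sequence                                          ∎
    where
    open ≡-Reasoning
    on-leaf : ∀ {w} → w ∉ spine → stat cutStat k (sizes (w ∷ [])) ≡ 0
    on-leaf {w} w∉ = trans (cong (stat cutStat k) (sizes-leaf w∉)) (cutStat-1 k (topSize (w ∷ []) root))

  -- Two spine edges leave no part 1; two leaf edges leave 1, 1 and `n - 2`, all different from `k`
  -- by the two bounds; a leaf edge and a spine edge are the case of `mixedStat-spine`.
  ∑-mixedStat : ∀ k → 2 ≤ k → suc (suc k) < n →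
    ∑ (subsets E) (stat mixedStat k ∘ λpart) ≡ cuts (λ xs ys → sameSide (suc k) xs ys + otherSide k xs ys) sequence
  ∑-mixedStat k 2≤k k<n = begin
    ∑ (subsets E) (stat mixedStat k ∘ λpart)
      ≡⟨ ∑-subsets-stat mixedStat k ⟩
    ∑removed E (λ Rs → stat mixedStat k (sizes (map child Rs)))
      ≡⟨ ∑removed-two E refl (λ _ → refl) (λ _ _ _ _ → refl) ⟩
    ∑pairs E (λ e e′ → f (child e) (child e′))
      ≡⟨ ∑pairs-map child E f ⟨
    ∑pairs (map child E) f
      ≡⟨ ∑pairs-↭ f (λ x y → stat-↭ mixedStat k (sizes-swap x y)) children ⟩
    ∑pairs (leafList ++ spineTail) f
      ≡⟨ ∑pairs-++ leafList spineTail f ⟩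
    ∑pairs leafList f + ∑ leafList (λ w → ∑ spineTail (f w)) + ∑pairs spineTail f
      ≡⟨ cong₂ _+_ (cong₂ _+_ (∑pairs-zero leafList-unique on-leaves) (∑-swap leafList spineTail f))
                   (∑pairs-zero (AllPairs.tail spine-unique) on-spine) ⟩
    ∑ spineTail (λ y → ∑ leafList (λ w → f w y)) + 0
      ≡⟨ +-identityʳ _ ⟩
    ∑ spineTail (λ y → ∑ leafList (λ w → f w y))
      ≡⟨ ∑-spineTail _ _ (λ cut → mixedStat-spine cut k 2≤k) ⟩
    cuts (λ xs ys → sameSide (suc k) xs ys + otherSide k xs ys) sequence ∎
    where
    open ≡-Reasoning
    f : V → V → ℕ
    f x y = stat mixedStat k (sizes (x ∷ y ∷ []))
    on-leaves : ∀ {x y} → x ∈ leafList → y ∈ leafList → x ≢ y → f x y ≡ 0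
    on-leaves {x} {y} x∈ y∈ x≢y = begin
      stat mixedStat k (sizes (x ∷ y ∷ []))                          ≡⟨ cong (stat mixedStat k) (sizes-two-leaves (leaf⇒∉ x∈) (leaf⇒∉ y∈) x≢y) ⟩
      stat mixedStat k (s ∷ 1 ∷ 1 ∷ [])                              ≡⟨ mixedStat-1 k s 1 ⟩
      occ k (s ∷ 1 ∷ 1 ∷ [])                                         ≡⟨ occ-∷ k s _ ⟩
      χ (s ≡ᵇ k) + occ k (1 ∷ 1 ∷ [])                                ≡⟨ cong₂ _+_ (cong χ (≢⇒≡ᵇ-false s≢k)) (trans (occ-∷ k 1 _) (cong (χ (1 ≡ᵇ k) +_) (occ-∷ k 1 []))) ⟩
      χ (1 ≡ᵇ k) + (χ (1 ≡ᵇ k) + 0)                                  ≡⟨ cong (λ b → χ b + (χ b + 0)) (≢⇒≡ᵇ-false (<⇒≢ 2≤k)) ⟩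
      0                                                              ∎
      where
      s : ℕ
      s = topSize (x ∷ y ∷ []) root
      s≢k : s ≢ k
      s≢k s≡k = <⇒≢ k<n (trans (+-comm 2 k) (trans (cong (_+ 2) (sym s≡k)) (topSize-two-leaves (leaf⇒∉ x∈) (leaf⇒∉ y∈) x≢y)))
    on-spine : ∀ {x y} → x ∈ spineTail → y ∈ spineTail → x ≢ y → f x y ≡ 0
    on-spine x∈ y∈ _ rewrite sizes-spine (tail∈ x∈ ∷ tail∈ y∈ ∷ []) = refl

-- Proper caterpillars as rooted trees

lookup-injective : ∀ {A : Set} {xs : List A} → Unique xs → ∀ i j → lookup xs i ≡ lookup xs j → i ≡ j
lookup-injective (x≢ ∷ u) zero zero eq = refl
lookup-injective {xs = x ∷ xs} (x≢ ∷ u) zero (suc j) eq = contradiction eq (All.lookup x≢ (∈-lookup j))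
lookup-injective {xs = x ∷ xs} (x≢ ∷ u) (suc i) zero eq = contradiction (sym eq) (All.lookup x≢ (∈-lookup i))
lookup-injective (x≢ ∷ u) (suc i) (suc j) eq = cong suc (lookup-injective u i j eq)

linked-lookup : ∀ {A : Set} {R : A → A → Set} (xs : List A) →
  (∀ i j → suc (toℕ i) ≡ toℕ j → R (lookup xs i) (lookup xs j)) → Linked R xs
linked-lookup [] r = []
linked-lookup (x ∷ []) r = [-]
linked-lookup (x ∷ y ∷ xs) r = r zero (suc zero) refl ∷ linked-lookup (y ∷ xs) λ i j eq → r (suc i) (suc j) (cong suc eq)

module _ {A : Set} (P : A → Bool) where

  count-positive : ∀ {xs x} → x ∈ xs → T (P x) → 1 ≤ count P xs
  count-positive {xs} x∈ Px = subst₂ _<_ (∑-zero xs) (sym (count≡∑ P xs)) (∑-mono-< (λ _ → z≤n) x∈ (χ-< {false} (λ ()) Px))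

  count-<2-unique : ∀ {xs x y} → count P xs < 2 → x ∈ xs → y ∈ xs → T (P x) → T (P y) → x ≡ y
  count-<2-unique c (here refl) (here refl) Px Py = refl
  count-<2-unique {x ∷ xs} c (here refl) (there y∈) Px Py with true ← P x =
    contradiction (s≤s (count-positive y∈ Py)) (<⇒≱ c)
  count-<2-unique {y ∷ xs} c (there x∈) (here refl) Px Py with true ← P y =
    contradiction (s≤s (count-positive x∈ Px)) (<⇒≱ c)
  count-<2-unique {z ∷ xs} c (there x∈) (there y∈) Px Py with P z
  ... | true = count-<2-unique (≤-trans (n≤1+n _) c) x∈ y∈ Px Py
  ... | false = count-<2-unique c x∈ y∈ Px Py

module ProperCaterpillar {n} (G : Graph n) (r : Fin n) (rs : List (Fin n)) (properSpine : ProperSpine G (r ∷ rs)) where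
  open ProperSpine properSpine renaming (tree to isTree; distinct to spine-unique)
  open DecMembership (Fin._≟_ {n}) using (_∈?_)

  private
    V = Fin n
    E = edges G
    spine = r ∷ rs

  incident : ∀ {w x} → Adj E w x → ∃ λ e → e ∈ E × T (eqF w (proj₁ e) ∨ eqF w (proj₂ e)) × (e ≡ (w , x) ⊎ e ≡ (x , w))
  incident {w} {x} a with to (Adj-⇔ E w x) a
  ... | inj₁ e∈ = (w , x) , e∈ , from T-∨ (inj₁ (eqF-refl w)) , inj₁ refl
  ... | inj₂ e∈ = (x , w) , e∈ , from (T-∨ {eqF w x}) (inj₂ (eqF-refl w)) , inj₂ refl

  module _ {w} (w∉ : w ∉ spine) where

    deg-<2 : deg E w < 2
    deg-<2 = ≰⇒> (w∉ ∘ from (internal w))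

    neighbour-unique : ∀ {x y} → Adj E w x → Adj E w y → x ≡ y
    neighbour-unique a b with e , e∈ , we , e≡ ← incident a with e′ , e′∈ , we′ , e′≡ ← incident b
      with refl ← count-<2-unique _ deg-<2 e∈ e′∈ we we′ with e≡ | e′≡
    ... | inj₁ refl | inj₁ refl = refl
    ... | inj₁ refl | inj₂ refl = refl
    ... | inj₂ refl | inj₁ refl = refl
    ... | inj₂ refl | inj₂ refl = refl

    deg-1 : ∀ {x} → Adj E w x → deg E w ≡ 1
    deg-1 a with e , e∈ , we , _ ← incident a = ≤-antisym (≤-pred deg-<2) (count-positive _ e∈ we)

  -- Vertices off the spine have at most one neighbour, so a walk from such an adjacent pair goes
  -- back and forth between the two and never reaches `r`.
  isolated-pair : ∀ {w x u} → w ∉ spine → x ∉ spine → Adj E w x → u ≡ w ⊎ u ≡ x → ¬ Walk E u r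
  isolated-pair w∉ x∉ a (inj₁ refl) here = w∉ (here refl)
  isolated-pair w∉ x∉ a (inj₂ refl) here = x∉ (here refl)
  isolated-pair w∉ x∉ a (inj₁ refl) (there b walk) = isolated-pair w∉ x∉ a (inj₂ (neighbour-unique w∉ b a)) walk
  isolated-pair w∉ x∉ a (inj₂ refl) (there b walk) = isolated-pair w∉ x∉ a (inj₁ (neighbour-unique x∉ b (Adj-sym E a))) walk

  neighbour : ∀ {w} → w ∉ spine → ∃ λ x → Adj E w x × x ∈ spine
  neighbour {w} w∉ with proj₁ (proj₂ isTree) w r
  ... | here = contradiction (here refl) w∉
  ... | there {w = x} a walk with x ∈? spine
  ...   | yes x∈ = x , a , x∈
  ...   | no x∉ = contradiction walk (isolated-pair w∉ x∉ a (inj₂ refl))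

  predecessor : Fin (length spine) → V
  -- A placeholder: the conditions on `parent` exclude the root.
  predecessor zero = r
  predecessor (suc i) = lookup spine (inject₁ i)

  parent foot : V → V
  parent v with v ∈? spine
  ... | yes v∈ = predecessor (Any.index v∈)
  ... | no v∉ = proj₁ (neighbour v∉)
  foot v with v ∈? spine
  ... | yes v∈ = v
  ... | no v∉ = proj₁ (neighbour v∉)

  depth : V → ℕ
  depth v with v ∈? spine
  ... | yes v∈ = toℕ (Any.index v∈)
  -- This exceeds every index on the spine, so a leaf is deeper than its foot wherever that is;
  -- `depth` is not the distance from the root.
  ... | no _ = length spine

  index-lookup : ∀ {i} (v∈ : lookup spine i ∈ spine) → Any.index v∈ ≡ i
  index-lookup {i} v∈ = lookup-injective spine-unique _ _ (sym (Any.lookup-index v∈))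

  depth-lookup : ∀ i → depth (lookup spine i) ≡ toℕ i
  depth-lookup i with lookup spine i ∈? spine
  ... | yes v∈ = cong toℕ (index-lookup v∈)
  ... | no v∉ = contradiction (∈-lookup i) v∉

  parent-lookup : ∀ i → parent (lookup spine i) ≡ predecessor i
  parent-lookup i with lookup spine i ∈? spine
  ... | yes v∈ = cong predecessor (index-lookup {i} v∈)
  ... | no v∉ = contradiction (∈-lookup i) v∉

  spine-lookup : ∀ {v} → v ∈ spine → ∃ λ i → v ≡ lookup spine i
  spine-lookup v∈ = Any.index v∈ , Any.lookup-index v∈

  foot∈ : ∀ v → foot v ∈ spine
  foot∈ v with v ∈? spine
  ... | yes v∈ = v∈
  ... | no v∉ = proj₂ (proj₂ (neighbour v∉))

  foot-spine : ∀ {v} → v ∈ spine → foot v ≡ v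
  foot-spine {v} v∈ with v ∈? spine
  ... | yes _ = refl
  ... | no v∉ = contradiction v∈ v∉

  leaf-parent : ∀ {v} → v ∉ spine → parent v ≡ foot v
  leaf-parent {v} v∉ with v ∈? spine
  ... | yes v∈ = contradiction v∈ v∉
  ... | no _ = refl

  leaf-depth : ∀ {v} → v ∉ spine → depth v ≡ length spine
  leaf-depth {v} v∉ with v ∈? spine
  ... | yes v∈ = contradiction v∈ v∉
  ... | no _ = refl

  foot-adj : ∀ {v} → v ∉ spine → Adj E v (foot v)
  foot-adj {v} v∉ with v ∈? spine
  ... | yes v∈ = contradiction v∈ v∉
  ... | no v∉ = proj₁ (proj₂ (neighbour v∉))

  depth-spine< : ∀ {v} → v ∈ spine → depth v < length spine
  depth-spine< v∈ with i , refl ← spine-lookup v∈ = subst (_< length spine) (sym (depth-lookup i)) (Fin.toℕ<n i)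

  spine-parent : ∀ {v} → v ∈ spine → v ≢ r → parent v ∈ spine × depth v ≡ suc (depth (parent v)) × Adj E v (parent v)
  spine-parent v∈ v≢ with spine-lookup v∈
  ... | zero , refl = contradiction refl v≢
  ... | suc i , refl rewrite parent-lookup (suc i) | depth-lookup (suc i) | depth-lookup (inject₁ i) | Fin.toℕ-inject₁ i =
    ∈-lookup (inject₁ i) , refl , from (inducedPath (suc i) (inject₁ i)) (inj₂ (cong suc (Fin.toℕ-inject₁ i)))

  leaf-depth-parent : ∀ {v} → v ∉ spine → depth (parent v) < depth v
  leaf-depth-parent {v} v∉ rewrite leaf-parent v∉ | leaf-depth v∉ = depth-spine< (foot∈ v)

  descends : ∀ v → v ≢ r → depth (parent v) < depth v
  descends v v≢ = [ (λ v∈ → ≤-reflexive (sym (proj₁ (proj₂ (spine-parent v∈ v≢)))))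
                  , leaf-depth-parent ]′ (toSum (v ∈? spine))

  parent-adj : ∀ v → v ≢ r → Adj E v (parent v)
  parent-adj v v≢ = [ (λ v∈ → proj₂ (proj₂ (spine-parent v∈ v≢)))
                    , (λ v∉ → subst (Adj E v) (sym (leaf-parent v∉)) (foot-adj v∉)) ]′ (toSum (v ∈? spine))

  ChildOf : V → V → Set
  ChildOf v u = v ≢ r × parent v ≡ u × depth u < depth v

  leaf-childOf : ∀ {v u} → v ∉ spine → Adj E v u → ChildOf v u
  leaf-childOf {v} v∉ a with refl ← neighbour-unique v∉ a (foot-adj v∉) =
    (λ { refl → v∉ (here refl) }) , leaf-parent v∉ , subst (λ u → depth u < depth v) (leaf-parent v∉) (leaf-depth-parent v∉)

  consecutive : ∀ i j → suc (toℕ i) ≡ toℕ j → ChildOf (lookup spine j) (lookup spine i)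
  consecutive i (suc j) eq =
    (λ eq′ → All.lookup (AllPairs.head spine-unique) (∈-lookup j) (sym eq′)) ,
    trans (parent-lookup (suc j)) (cong (lookup spine) (Fin.toℕ-injective (trans (Fin.toℕ-inject₁ j) (sym (suc-injective eq))))) ,
    ≤-reflexive (trans (cong suc (depth-lookup i)) (trans eq (sym (depth-lookup (suc j)))))

  -- An endpoint off the spine must be the child, as its only neighbour is its foot. Two adjacent
  -- spine vertices are consecutive because the spine is an induced path.
  adj-childOf : ∀ u v → Adj E u v → ChildOf v u ⊎ ChildOf u v
  adj-childOf u v a = cases (toSum (u ∈? spine)) (toSum (v ∈? spine))
    where
    cases : u ∈ spine ⊎ u ∉ spine → v ∈ spine ⊎ v ∉ spine → ChildOf v u ⊎ ChildOf u v
    cases (inj₂ u∉) _ = inj₂ (leaf-childOf u∉ a)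
    cases _ (inj₂ v∉) = inj₁ (leaf-childOf v∉ (Adj-sym E a))
    cases (inj₁ u∈) (inj₁ v∈) with i , refl ← spine-lookup u∈ | j , refl ← spine-lookup v∈ | to (inducedPath i j) a
    ... | inj₁ eq = inj₁ (consecutive i j eq)
    ... | inj₂ eq = inj₂ (consecutive j i eq)

  child : Edge n → V
  child (u , v) = if does (depth u <? depth v) then v else u

  child-< : ∀ u v → depth u < depth v → child (u , v) ≡ v
  child-< u v u<v rewrite dec-true (depth u <? depth v) u<v = refl

  child-> : ∀ u v → depth v < depth u → child (u , v) ≡ u
  child-> u v v<u rewrite dec-false (depth u <? depth v) (<-asym v<u) = refl

  EdgeAbove : Edge n → V → Set
  EdgeAbove e c = c ≢ r × (e ≡ (c , parent c) ⊎ e ≡ (parent c , c))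

  child-edge : ∀ {e} → e ∈ E → EdgeAbove e (child e)
  child-edge {u , v} e∈ with adj-childOf u v (from (Adj-⇔ E u v) (inj₁ e∈))
  ... | inj₁ (v≢ , p≡ , u<v) = subst (EdgeAbove (u , v)) (sym (child-< u v u<v)) (v≢ , inj₂ (cong (_, v) (sym p≡)))
  ... | inj₂ (u≢ , p≡ , v<u) = subst (EdgeAbove (u , v)) (sym (child-> u v v<u)) (u≢ , inj₁ (cong (u ,_) (sym p≡)))

  -- `c` determines the unordered edge, and both orientations cannot occur because edges are listed
  -- with the smaller endpoint first.
  edgeAbove-unique : ∀ {e e′ c} → e ∈ E → e′ ∈ E → EdgeAbove e c → EdgeAbove e′ c → e ≡ e′
  edgeAbove-unique e∈ e′∈ (_ , inj₁ refl) (_ , inj₁ refl) = refl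
  edgeAbove-unique e∈ e′∈ (_ , inj₂ refl) (_ , inj₂ refl) = refl
  edgeAbove-unique e∈ e′∈ (_ , inj₁ refl) (_ , inj₂ refl) =
    contradiction (All.lookup (ordered G) e′∈) (<-asym (All.lookup (ordered G) e∈))
  edgeAbove-unique e∈ e′∈ (_ , inj₂ refl) (_ , inj₁ refl) =
    contradiction (All.lookup (ordered G) e′∈) (<-asym (All.lookup (ordered G) e∈))

  child-injective : ∀ {e e′} → e ∈ E → e′ ∈ E → child e ≡ child e′ → e ≡ e′
  child-injective e∈ e′∈ eq = edgeAbove-unique e∈ e′∈ (child-edge e∈) (subst (EdgeAbove _) (sym eq) (child-edge e′∈))

  complete : ∀ v → v ≢ r → v ∈ map child E
  complete v v≢ with to (Adj-⇔ E v (parent v)) (parent-adj v v≢)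
  ... | inj₁ e∈ = subst (_∈ map child E) (child-> v (parent v) (descends v v≢)) (∈-map⁺ child e∈)
  ... | inj₂ e∈ = subst (_∈ map child E) (child-< (parent v) v (descends v v≢)) (∈-map⁺ child e∈)

  caterpillar : Caterpillar E
  caterpillar = record
    { tree = record
      { root = r ; parent = parent ; depth = depth ; descends = descends ; child = child
      ; child≢ = λ e∈ → proj₁ (child-edge e∈) ; edge = λ e∈ → proj₂ (child-edge e∈)
      ; distinct = unique-map child-injective (noDup G) ; complete = complete }
    ; spineTail = rs
    ; spine-unique = spine-unique
    ; spine-depths = linked-lookup spine λ i j eq → trans (depth-lookup j) (trans (sym eq) (cong suc (sym (depth-lookup i))))
    ; spine-parent = λ v∈ v≢ → let p∈ , d≡ , _ = spine-parent v∈ v≢ in p∈ , d≡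
    ; foot = foot ; foot∈ = foot∈ ; foot-spine = foot-spine
    ; leaf-parent = leaf-parent
    ; leaf = leaf }
    where
    leaf : ∀ {v} → v ∈ spine → ∃ λ w → w ∉ spine × foot w ≡ v
    leaf {v} v∈ with w , a , deg≡1 ← All.lookup proper v∈ =
      w , w∉ , neighbour-unique w∉ (foot-adj w∉) (Adj-sym E a)
      where
      w∉ : w ∉ spine
      w∉ w∈ = <⇒≢ (to (internal w) w∈) (sym deg≡1)

  -- Spine vertices have degree at least 2 and never count. Any other vertex has degree 1 and its
  -- foot as sole neighbour, so it counts precisely when its foot is `v`.
  leavesAt-leavesOn : ∀ {v} → v ∈ spine → leavesAt E v ≡ leavesOn caterpillar v
  leavesAt-leavesOn {v} v∈ = begin
    leavesAt E v                                                    ≡⟨ count≡∑ _ (allFin n) ⟩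
    ∑ (allFin n) (χ ∘ leafAt)                                       ≡⟨ ∑-↭ (χ ∘ leafAt) (spine++leafList caterpillar) ⟩
    ∑ (spine ++ leafList caterpillar) (χ ∘ leafAt)                  ≡⟨ ∑-++ spine (leafList caterpillar) _ ⟩
    ∑ spine (χ ∘ leafAt) + ∑ (leafList caterpillar) (χ ∘ leafAt)    ≡⟨ cong₂ _+_ (trans (∑-cong-∈ spine on-spine) (∑-zero spine))
                                                                         (∑-cong-∈ (leafList caterpillar) (on-leaf ∘ leaf⇒∉ caterpillar)) ⟩
    leavesOn caterpillar v                                          ∎
    where
    open ≡-Reasoning
    leafAt : V → Bool
    leafAt w = adjB E v w ∧ (deg E w ≡ᵇ 1)
    on-spine : ∀ {w} → w ∈ spine → χ (leafAt w) ≡ 0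
    on-spine {w} w∈ = χ-cong {leafAt w} {false}
      (λ t → <⇒≢ (to (internal w) w∈) (sym (≡ᵇ⇒≡ (deg E w) 1 (proj₂ (to (T-∧ {adjB E v w}) t))))) λ ()
    on-leaf : ∀ {w} → w ∉ spine → χ (leafAt w) ≡ χ (does (foot w Fin.≟ v))
    on-leaf {w} w∉ = χ-cong
      (λ t → subst T (sym (dec-true (foot w Fin.≟ v) (neighbour-unique w∉ (foot-adj w∉) (Adj-sym E (proj₁ (to (T-∧ {adjB E v w}) t)))))) _)
      (λ t → from (T-∧ {adjB E v w}) (adjacent (does-≟⇒≡ t)))
      where
      adjacent : foot w ≡ v → Adj E v w × T (deg E w ≡ᵇ 1)
      adjacent refl = Adj-sym E (foot-adj w∉) , ≡⇒≡ᵇ (deg E w) 1 (deg-1 w∉ (foot-adj w∉))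

  sequence-spineSeq : sequence caterpillar ≡ spineSeq G spine
  sequence-spineSeq = map-cong-local (All.tabulate λ v∈ → cong suc (sym (leavesAt-leavesOn v∈)))

-- From equal polynomials to the theorem

2≤sequence : ∀ {n} {E : List (Edge n)} (cat : Caterpillar E) → All (2 ≤_) (sequence cat)
2≤sequence cat = All.map⁺ (All.tabulate λ {v} v∈ → s≤s (positive v∈))
  where
  open Caterpillar cat
  positive : ∀ {v} → v ∈ spine → 1 ≤ leavesOn cat v
  positive {v} v∈ with w , w∉ , refl ← leaf v∈ =
    subst (_< leavesOn cat v) (∑-zero (leafList cat))
      (∑-mono-< (λ _ → z≤n) (∉⇒leaf cat w∉) (subst (λ b → 0 < χ b) (sym (dec-true (v Fin.≟ v) refl)) (s≤s z≤n)))

hasΦ⇒caterpillar : ∀ {n} {G : Graph n} {c} → HasΦ G c →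
  ∃ λ (cat : Caterpillar (edges G)) → sequence cat ≡ c ⊎ sequence cat ≡ reverse c
hasΦ⇒caterpillar ([] , ps , _) = contradiction (ProperSpine.nontrivial ps) λ ()
hasΦ⇒caterpillar {G = G} (r ∷ rs , ps , inj₁ eq) = caterpillar , inj₁ (trans sequence-spineSeq eq)
  where open ProperCaterpillar G r rs ps
hasΦ⇒caterpillar {G = G} (r ∷ rs , ps , inj₂ eq) = caterpillar , inj₂ (trans sequence-spineSeq eq)
  where open ProperCaterpillar G r rs ps

-- `U G μ` is the multiplicity of `μ` among the partitions of all edge sets. Equal coefficients make
-- the two lists of partitions permutations of each other, so every `F` has the same total on both.
U-determines : ∀ {m n} (S : Graph m) (T : Graph n) → (∀ μ → U S μ ≡ U T μ) →
  ∀ (F : List ℕ → ℕ) → ∑ (subsets (edges S)) (F ∘ λpart) ≡ ∑ (subsets (edges T)) (F ∘ λpart)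
U-determines S T U≡ F = trans (sym (∑-map λpart (subsets (edges S)) F)) (trans (∑-↭ F same) (∑-map λpart (subsets (edges T)) F))
  where
  same : map λpart (subsets (edges S)) ↭ map λpart (subsets (edges T))
  same = counts⇒↭ (≡-dec _≟_) _ _ λ μ → trans (count-map _ λpart (subsets (edges S)))
    (trans (U≡ μ) (sym (count-map _ λpart (subsets (edges T)))))

theorem3p3 : (α β γ : List ℕ) → IsComposition α → IsComposition β → IsComposition γ →
    sum α ≡ sum β → {m n : ℕ} (S : Graph m) (T : Graph n) →
    HasΦ S (α ∘c γ) → HasΦ T (β ∘c γ) →
    reverse γ ≢ γ → α ≢ β →
    ¬ ((μ : List ℕ) → U S μ ≡ U T μ)
theorem3p3 α β γ pα pβ pγ sum≡ {m} {n} S T ΦS ΦT γ≢ α≢β U≡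
  with s , b≡ ← hasΦ⇒caterpillar ΦS | t , c≡ ← hasΦ⇒caterpillar ΦT =
  sameSide-distinguishes pα pβ pγ sum≡ γ≢ α≢β b≡ c≡ (2≤sequence s) (2≤sequence t)
    (sameSide-determined (2≤sequence s) (2≤sequence t)
      (trans (sym (∑-leafStat s)) (trans (U-determines S T U≡ (stat leafStat 0)) (∑-leafStat t)))
      (λ k → trans (sym (∑-cutStat s k)) (trans (U-determines S T U≡ (stat cutStat k)) (∑-cutStat t k)))
      λ k 2≤k k< → trans (sym (cuts-+ (sameSide (suc k)) (otherSide k) (sequence s))) (trans
        (sym (∑-mixedStat s k 2≤k (subst (suc (suc k) <_) (sum-sequence s) k<)))
        (trans (U-determines S T U≡ (stat mixedStat k)) (trans
        (∑-mixedStat t k 2≤k (subst (suc (suc k) <_) (trans sums (sum-sequence t)) k<))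
        (cuts-+ (sameSide (suc k)) (otherSide k) (sequence t))))))
  where
  -- These sums are the numbers of vertices of the two trees; their equality carries the upper bound
  -- on `k` from one tree to the other.
  sums : sum (sequence s) ≡ sum (sequence t)
  sums = begin
    sum (sequence s)        ≡⟨ sum-of-reverse (α ∘c γ) b≡ ⟩
    sum (α ∘c γ)            ≡⟨ sum-∘c α γ ⟩
    sum α * sum γ           ≡⟨ cong (_* sum γ) sum≡ ⟩
    sum β * sum γ           ≡⟨ sum-∘c β γ ⟨
    sum (β ∘c γ)            ≡⟨ sum-of-reverse (β ∘c γ) c≡ ⟨
    sum (sequence t)        ∎
    where open ≡-Reasoning
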